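{- Let $k>3$ be a prime power. For every $v$ with $2k\leq v<4k$ and $v(v-1)\equiv 0\pmod{2k}$, \[\mathcal{L}_1S_k(v)=\{n\geq v-1\mid n\equiv 0,1\pmod 4\}.\]
   Context: All graphs are finite and simple; $\Gamma\leq K$ means $\Gamma$ is a subgraph of $K$ (or is isomorphic to one, when $\Gamma$ is an abstract graph). $P_3$ is the path on $3$ vertices; $S_k$ is the star on $k+1$ vertices, i.e. the complete bipartite graph $K_{1,k}$. For a graph $K$ and $\Gamma\leq K$, a $(K,\Gamma)$-design is a set $\mathcal{B}$ of subgraphs of $K$, called blocks, each isomorphic to $\Gamma$, whose edge-sets partition $E(K)$. $K_n$ is the complete graph on a set of $n$ vertices (any $n$-element vertex set may be used); a $\Gamma$-design of order $n$ is a $(K_n,\Gamma)$-design. Given $\Gamma'\leq\Gamma$, a $(K,\Gamma)$-design $\mathcal{B}$ and a $(K',\Gamma')$-design $\mathcal{B}'$, a down-link from $\mathcal{B}$ to $\mathcal{B}'$ is a function $f:\mathcal{B}\to\mathcal{B}'$ such that $f(B)$ is a subgraph of $B$ for every $B\in\mathcal{B}$ (the vertex sets of $K$ and $K'$ need not coincide, and either may be the larger). Take $\Gamma'=P_3$. For $v$ such that a $(K_v,\Gamma)$-design exists, $\mathcal{L}_1\Gamma(v)$ is the set of all integers $n$ such that some $\Gamma$-design of order $v$ can be down-linked to a $P_3$-design of order $n$. A $(K_v,S_k)$-design exists if and only if $v\geq 2k$ and $v(v-1)\equiv 0\pmod{2k}$. -}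

module Defs where

open import Data.Empty using (⊥-elim)
open import Data.Fin using (Fin)
open import Data.List using (List; length; upTo)
open import Data.List.Membership.DecPropositional using () renaming (_∈?_ to mem?)
open import Data.List.Membership.Propositional using (_∈_)
open import Data.List.Membership.Propositional.Properties using (∈-upTo⁺)
open import Data.List.Relation.Binary.Subset.Propositional using (_⊆_)
open import Data.List.Relation.Unary.Unique.Propositional using (Unique)
open import Data.List.Relation.Unary.Unique.Propositional.Properties using (upTo⁺)
open import Data.Nat using (ℕ; suc; _+_; _^_; _≤_; _<_; _≟_; _<?_; _≤?_)
open import Data.Nat.Primality using (Prime)
open import Data.Nat.Properties using (<-≤-trans; m≤m+n; <-irrefl; 1+n≢n)
open import Data.Product using (Σ-syntax; ∃!; ∃₂; _×_; _,_; proj₁)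
open import Data.Sum using (_⊎_; inj₁; inj₂; swap)
open import Function.Bundles using (_⇔_)
open import Level using (0ℓ) renaming (suc to lsuc)
open import Relation.Binary.Core using (Rel)
open import Relation.Binary.Definitions using (Decidable; Symmetric; Irreflexive)
open import Relation.Binary.PropositionalEquality using (_≡_; _≢_; refl; sym)
open import Relation.Nullary.Decidable using (_×-dec_; _⊎-dec_; ¬?)
open import Relation.Unary using (Pred)

IsPrimePower : ℕ → Set
IsPrimePower q = ∃₂ λ p m → Prime p × 1 ≤ m × q ≡ p ^ m

-- Finite simple graphs.  All vertices are taken from the common infinite
-- supply ℕ, so that vertex sets of different graphs may coincide, overlap or
-- be disjoint, and "being a subgraph" is a literal inclusion.  The vertex set
-- is a duplicate-free list whose order plays no role; decidability of
-- adjacency is what makes the edge set an honest finite set constructively.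
record Graph : Set₁ where
  field
    vertices   : List ℕ
    unique     : Unique vertices
    Adj        : Rel ℕ 0ℓ
    adj?       : Decidable Adj
    symmetric  : Symmetric Adj
    loopless   : Irreflexive _≡_ Adj
    adj-vertex : ∀ {x y} → Adj x y → x ∈ vertices

open Graph public

infix 4 _⊑_ _≅_

record _⊑_ (G H : Graph) : Set where
  field
    vertices⊆ : vertices G ⊆ vertices H
    edges⊆    : ∀ {x y} → Adj G x y → Adj H x y

-- The values of to and from outside the respective vertex sets are irrelevant.
record _≅_ (G H : Graph) : Set where
  field
    to      : ℕ → ℕ
    from    : ℕ → ℕ
    to-∈    : ∀ {x} → x ∈ vertices G → to x ∈ vertices H
    from-∈  : ∀ {y} → y ∈ vertices H → from y ∈ vertices G
    from-to : ∀ {x} → x ∈ vertices G → from (to x) ≡ x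
    to-from : ∀ {y} → y ∈ vertices H → to (from y) ≡ y
    adj⇔    : ∀ {x y} → x ∈ vertices G → y ∈ vertices G →
              Adj G x y ⇔ Adj H (to x) (to y)

completeOn : (X : List ℕ) → Unique X → Graph
completeOn X X! = record
  { vertices   = X
  ; unique     = X!
  ; Adj        = λ x y → x ∈ X × y ∈ X × x ≢ y
  ; adj?       = λ x y → mem? _≟_ x X ×-dec mem? _≟_ y X ×-dec ¬? (x ≟ y)
  ; symmetric  = λ (x∈ , y∈ , x≢y) → y∈ , x∈ , λ eq → x≢y (sym eq)
  ; loopless   = λ eq (_ , _ , x≢y) → x≢y eq
  ; adj-vertex = proj₁
  }

path : ℕ → Graph
path n = record
  { vertices   = upTo n
  ; unique     = upTo⁺ n
  ; Adj        = λ x y → x < n × y < n × (suc x ≡ y ⊎ suc y ≡ x)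
  ; adj?       = λ x y → x <? n ×-dec y <? n ×-dec (suc x ≟ y ⊎-dec suc y ≟ x)
  ; symmetric  = λ (x< , y< , e) → y< , x< , swap e
  ; loopless   = λ { refl (_ , _ , inj₁ e) → 1+n≢n e
                   ; refl (_ , _ , inj₂ e) → 1+n≢n e }
  ; adj-vertex = λ (x< , _) → ∈-upTo⁺ x<
  }

-- The parts are {0,…,m-1} and {m,…,m+n-1}.
completeBipartite : ℕ → ℕ → Graph
completeBipartite m n = record
  { vertices   = upTo (m + n)
  ; unique     = upTo⁺ (m + n)
  ; Adj        = λ x y → Cross x y ⊎ Cross y x
  ; adj?       = λ x y → cross? x y ⊎-dec cross? y x
  ; symmetric  = swap
  ; loopless   = λ { refl (inj₁ c) → absurd c ; refl (inj₂ c) → absurd c }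
  ; adj-vertex = λ { (inj₁ (x<m , _))      → ∈-upTo⁺ (<-≤-trans x<m (m≤m+n m n))
                   ; (inj₂ (_ , _ , x<m+n)) → ∈-upTo⁺ x<m+n }
  }
  where
  Cross : Rel ℕ 0ℓ
  Cross x y = x < m × m ≤ y × y < m + n

  cross? : Decidable Cross
  cross? x y = x <? m ×-dec m ≤? y ×-dec y <? m + n

  absurd : ∀ {x} {A : Set} → Cross x x → A
  absurd (x<m , m≤x , _) = ⊥-elim (<-irrefl refl (<-≤-trans x<m m≤x))

P₃ : Graph
P₃ = path 3

star : ℕ → Graph
star k = completeBipartite 1 k

-- (K , Γ)-designs.  The set of blocks is enumerated without repetition
-- (distinct) by Fin size; edges-partition says that every edge of K lies in
-- exactly one block.
record Design (K Γ : Graph) : Set₁ where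
  field
    size            : ℕ
    block           : Fin size → Graph
    block⊑K         : ∀ i → block i ⊑ K
    block≅Γ         : ∀ i → block i ≅ Γ
    distinct        : ∀ {i j} → block i ⊑ block j → block j ⊑ block i → i ≡ j
    edges-partition : ∀ {x y} → Adj K x y → ∃! _≡_ λ i → Adj (block i) x y

open Design public

-- A Γ-design of order n; the n-element vertex set is arbitrary.
record DesignOfOrder (n : ℕ) (Γ : Graph) : Set₁ where
  field
    points        : List ℕ
    points-unique : Unique points
    order         : length points ≡ n
    design        : Design (completeOn points points-unique) Γ

open DesignOfOrder public

DownLink : ∀ {K Γ K′ Γ′} → Design K Γ → Design K′ Γ′ → Set
DownLink 𝓑 𝓑′ =
  Σ[ f ∈ (Fin (size 𝓑) → Fin (size 𝓑′)) ] (∀ i → block 𝓑′ (f i) ⊑ block 𝓑 i)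

𝓛₁ : Graph → ℕ → Pred ℕ (lsuc 0ℓ)
𝓛₁ Γ v n = Σ[ 𝓑 ∈ DesignOfOrder v Γ ] Σ[ 𝓑′ ∈ DesignOfOrder n P₃ ]
             DownLink (design 𝓑) (design 𝓑′)

{-# OPTIONS --safe #-}

-- Necessity.  Counting ordered adjacent pairs, n(n-1) = 4 |𝓑′|.  Every edge of
-- K_v lies in a star whose centre is a point of 𝓑′ (one end of any edge of the
-- linked path is the centre), so at most one vertex of K_v is not such a point.
--
-- Sufficiency.  Since k is a prime power, v is 2k, 2k+1, or, for odd k, 3k or
-- 3k+1.  A tournament on {0,…,v-1} whose scores are multiples of k splits into
-- stars S_k.  Scores 0 for v-1 and k or 2k for all other vertices are reached
-- from an explicit tournament by reversing paths of length at most 2, each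
-- moving one unit of score from a vertex above its target to one below it.
-- If k ≥ 5, every star has two leaves other than v-1 and the predecessor and
-- successor of its centre; link them.  The linked paths thus avoid the edges
-- {i,i+1} of K_n, and reversing these one after another for i = 0,1,… makes all
-- scores on {0,…,n-1} even (the last one because n(n-1)/2 is even).  The
-- unlinked out-edges of each vertex are then paired arbitrarily.  For k = 4 the
-- two designs are explicit.
module Submission where

open import Defs
open import Data.Bool using (Bool; true; false; not; _∧_; _xor_)
import Data.Bool.Properties as Bool
open import Data.Empty using (⊥-elim)
open import Data.Fin as Fin using (Fin)
open import Data.List using (List; []; _∷_; _++_; map; concat; concatMap; filter; length; upTo; allFin; lookup; take; drop)
import Data.List.Membership.DecPropositional as DecMembership
open import Data.List.Membership.Propositional using (_∈_; _∉_; find; lose)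
open import Data.List.Membership.Propositional.Properties
open import Data.List.Membership.Propositional.Properties.WithK using (unique∧set⇒bag)
open import Data.List.Properties using (length-++; length-map; length-tabulate; length-upTo; length-deduplicate; length-take; length-drop; concat-++; take++drop≡id; upTo-∷ʳ; filter-++)
open import Data.List.Relation.Binary.BagAndSetEquality using (∼bag⇒↭)
open import Data.List.Relation.Binary.Permutation.Propositional.Properties using (↭-length)
open import Data.List.Relation.Binary.Subset.Propositional using (_⊆_)
open import Data.List.Relation.Unary.All as All using (All; []; _∷_)
open import Data.List.Relation.Unary.All.Properties using (¬Any⇒All¬)
open import Data.List.Relation.Unary.AllPairs using ([]; _∷_)
open import Data.List.Relation.Unary.Any as Any using (here; there)
open import Data.List.Relation.Unary.Any.Properties using (lookup-index)
open import Data.List.Relation.Unary.Unique.DecPropositional.Properties using (deduplicate-!)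
open import Data.List.Relation.Unary.Unique.Propositional using (Unique)
import Data.List.Relation.Unary.Unique.Propositional.Properties as Unique
open import Data.Nat using (ℕ; zero; suc; _+_; _*_; _∸_; _^_; _/_; _≤_; _<_; z≤n; s≤s; s≤s⁻¹; _≟_; _≤?_; _<?_; _%_; ∣_-_∣; NonZero; >-nonZero)
open import Data.Nat.Divisibility
open import Data.Nat.DivMod using ([m+n]%n≡m%n)
open import Data.Nat.Induction using (<-wellFounded)
open import Data.Nat.Primality using (Prime; prime⇒irreducible; euclidsLemma; prime⇒nonZero; ¬prime[1])
open import Data.Nat.Properties
open import Data.Nat.Tactic.RingSolver using (solve-∀)
open import Data.Product as Product using (Σ; ∃; _×_; _,_; proj₁; proj₂)
open import Data.Sum using (_⊎_; inj₁; inj₂; swap)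
open import Data.Unit using (tt)
open import Function.Bundles using (_⇔_; mk⇔; Equivalence)
open import Induction.WellFounded using (Acc; acc)
open import Relation.Binary.PropositionalEquality
open import Relation.Nullary using (¬_; Dec; yes; no; does)
open import Relation.Nullary.Decidable using (¬?; _×-dec_; _⊎-dec_; dec-true; dec-false; does-⇔; toWitness)
open import Relation.Unary using (_≐_)

open DecMembership _≟_ using (_∈?_)
open Equivalence using () renaming (to to ⇒; from to ⇐)

-- Tournaments

∑ : ℕ → (ℕ → ℕ) → ℕ
∑ zero    f = 0
∑ (suc n) f = ∑ n f + f n

∑-cong : ∀ n {f g} → (∀ x → x < n → f x ≡ g x) → ∑ n f ≡ ∑ n g
∑-cong zero    eq = refl
∑-cong (suc n) eq = cong₂ _+_ (∑-cong n (λ x x<n → eq x (m<n⇒m<1+n x<n))) (eq n (n<1+n n))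

∑-mono : ∀ n {f g} → (∀ x → x < n → f x ≤ g x) → ∑ n f ≤ ∑ n g
∑-mono zero    le = z≤n
∑-mono (suc n) le = +-mono-≤ (∑-mono n (λ x x<n → le x (m<n⇒m<1+n x<n))) (le n (n<1+n n))

∑-strict : ∀ n {f g} → (∀ x → x < n → f x ≤ g x) → ∀ {y} → y < n → f y < g y → ∑ n f < ∑ n g
∑-strict (suc n) {f} {g} le {y} y<1+n lt with m<1+n⇒m<n∨m≡n y<1+n
... | inj₁ y<n  = +-mono-<-≤ (∑-strict n (λ x x<n → le x (m<n⇒m<1+n x<n)) y<n lt) (le n (n<1+n n))
... | inj₂ refl = +-mono-≤-< (∑-mono n (λ x x<n → le x (m<n⇒m<1+n x<n))) lt

∑-+ : ∀ n {f g} → ∑ n (λ x → f x + g x) ≡ ∑ n f + ∑ n g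
∑-+ zero = refl
∑-+ (suc n) {f} {g} = trans (cong (_+ (f n + g n)) (∑-+ n)) (lemma (∑ n f) (∑ n g) (f n) (g n))
  where
  lemma : ∀ a b c d → a + b + (c + d) ≡ a + c + (b + d)
  lemma = solve-∀

∑-const : ∀ n c → ∑ n (λ _ → c) ≡ n * c
∑-const zero    c = refl
∑-const (suc n) c = trans (cong (_+ c) (∑-const n c)) (+-comm (n * c) c)

∑-split : ∀ m n {f} → ∑ (m + n) f ≡ ∑ m f + ∑ n (λ x → f (m + x))
∑-split m zero    {f} = trans (cong (λ z → ∑ z f) (+-identityʳ m)) (sym (+-identityʳ _))
∑-split m (suc n) {f} =
  trans (cong (λ z → ∑ z f) (+-suc m n))
        (trans (cong (_+ f (m + n)) (∑-split m n)) (+-assoc (∑ m f) _ _))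

∑-step : ∀ n {f g y} → y < n → f y ≡ suc (g y) → (∀ x → x ≢ y → f x ≡ g x) → ∑ n f ≡ suc (∑ n g)
∑-step (suc n) {f} {g} {y} y<1+n fy eq with m<1+n⇒m<n∨m≡n y<1+n
... | inj₁ y<n  = cong₂ _+_ (∑-step n y<n fy eq) (eq n (≢-sym (<⇒≢ y<n)))
... | inj₂ refl = trans (cong₂ _+_ (∑-cong n (λ x x<n → eq x (<⇒≢ x<n))) fy) (+-suc _ _)

∑-≡-of-≤ : ∀ n {f g} → (∀ x → x < n → f x ≤ g x) → ∑ n f ≡ ∑ n g → ∀ x → x < n → f x ≡ g x
∑-≡-of-≤ n {f} {g} le eq x x<n with m≤n⇒m<n∨m≡n (le x x<n)
... | inj₁ lt  = ⊥-elim (<-irrefl eq (∑-strict n le x<n lt))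
... | inj₂ fx≡ = fx≡

-- The number n(n-1)/2 of edges of the complete graph on n vertices.
tri : ℕ → ℕ
tri zero    = 0
tri (suc n) = tri n + n

tri-*2 : ∀ n → tri n * 2 ≡ n * (n ∸ 1)
tri-*2 0 = refl
tri-*2 1 = refl
tri-*2 (suc (suc n)) = trans (*-distribʳ-+ 2 (tri (suc n)) (suc n))
                             (trans (cong (_+ suc n * 2) (tri-*2 (suc n))) (lemma n))
  where
  lemma : ∀ n → suc n * n + suc n * 2 ≡ suc (suc n) * suc n
  lemma = solve-∀

toℕ : Bool → ℕ
toℕ false = 0
toℕ true  = 1

toℕ-+-not : ∀ b → toℕ b + toℕ (not b) ≡ 1
toℕ-+-not false = refl
toℕ-+-not true  = refl

-- The relation lives on all of ℕ, so that one tournament can be restricted both to the v points of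
-- the star design and to the n points of the path design.
record Tournament : Set where
  field
    beats : ℕ → ℕ → Bool
    irrefl : ∀ x → beats x x ≡ false
    total : ∀ {x y} → x ≢ y → beats x y ≡ not (beats y x)

open Tournament public

score : Tournament → ℕ → ℕ → ℕ
score R n x = ∑ n (λ y → toℕ (beats R x y))

-- Passing from n to n + 1 adds, for every x < n, exactly one arc between x and n, whichever its
-- direction.
∑-score : ∀ R n → ∑ n (score R n) ≡ tri n
∑-score R zero    = refl
∑-score R (suc n) =
  trans (cong₂ _+_ (∑-+ n) (cong (score R n n +_) (cong toℕ (irrefl R n))))
  (trans (lemma (∑ n (score R n)) (∑ n (λ x → toℕ (beats R x n))) (score R n n))
  (cong₂ _+_ (∑-score R n) cross))
  where
  lemma : ∀ a b c → a + b + (c + 0) ≡ a + (b + c)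
  lemma = solve-∀
  cross : ∑ n (λ x → toℕ (beats R x n)) + score R n n ≡ n
  cross = trans (sym (∑-+ n))
    (trans (∑-cong n (λ x x<n → trans (cong (λ b → toℕ b + toℕ (beats R n x)) (total R (<⇒≢ x<n)))
                                 (trans (+-comm (toℕ (not (beats R n x))) _) (toℕ-+-not (beats R n x)))))
    (trans (∑-const n 1) (*-identityʳ n)))

SamePair : ℕ → ℕ → ℕ → ℕ → Set
SamePair x y u w = (u ≡ x × w ≡ y) ⊎ (u ≡ y × w ≡ x)

samePair? : ∀ x y u w → Dec (SamePair x y u w)
samePair? x y u w = (u ≟ x ×-dec w ≟ y) ⊎-dec (u ≟ y ×-dec w ≟ x)

-- Exclusive or with a symmetric relation reverses exactly the arcs between related vertices. This
-- serves for a single arc in `flip` and for whole families of arcs in `reverseOn`.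
toggle : (D : ℕ → ℕ → Bool) → (∀ x y → D x y ≡ D y x) → (∀ x → D x x ≡ false) → Tournament → Tournament
toggle D D-sym D-irr R = record
  { beats  = λ u w → D u w xor beats R u w
  ; irrefl = λ u → cong₂ _xor_ (D-irr u) (irrefl R u)
  ; total  = λ {u} {w} u≢w → trans (cong₂ _xor_ (D-sym u w) (total R u≢w)) (xor-not (D w u) _) }
  where
  xor-not : ∀ a b → a xor not b ≡ not (a xor b)
  xor-not false b = refl
  xor-not true  b = refl

flip : ∀ x y → x ≢ y → Tournament → Tournament
flip x y x≢y = toggle (λ u w → does (samePair? x y u w)) sym′ irr′
  where
  swap′ : ∀ {u w} → SamePair x y u w → SamePair x y w u
  swap′ (inj₁ (refl , refl)) = inj₂ (refl , refl)
  swap′ (inj₂ (refl , refl)) = inj₁ (refl , refl)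
  sym′ : ∀ u w → does (samePair? x y u w) ≡ does (samePair? x y w u)
  sym′ u w = does-⇔ (mk⇔ swap′ swap′) (samePair? x y u w) (samePair? x y w u)
  irr′ : ∀ u → does (samePair? x y u u) ≡ false
  irr′ u = dec-false (samePair? x y u u) λ where
    (inj₁ (p , q)) → x≢y (trans (sym p) q)
    (inj₂ (p , q)) → x≢y (trans (sym q) p)

module _ (R : Tournament) {x y : ℕ} (x≢y : x ≢ y) where

  flip-same : ∀ {u w} → SamePair x y u w → beats (flip x y x≢y R) u w ≡ not (beats R u w)
  flip-same {u} {w} p = cong (_xor beats R u w) (dec-true (samePair? x y u w) p)

  flip-other : ∀ {u w} → ¬ SamePair x y u w → beats (flip x y x≢y R) u w ≡ beats R u w
  flip-other {u} {w} ¬p = cong (_xor beats R u w) (dec-false (samePair? x y u w) ¬p)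

  module _ {n : ℕ} (x<n : x < n) (y<n : y < n) (x→y : beats R x y ≡ true) where

    score-flip-loser : score R n x ≡ suc (score (flip x y x≢y R) n x)
    score-flip-loser = ∑-step n y<n
      (trans (cong toℕ x→y) (cong (λ b → suc (toℕ b)) (sym (trans (flip-same (inj₁ (refl , refl))) (cong not x→y)))))
      (λ w w≢y → cong toℕ (sym (flip-other λ where
        (inj₁ (_ , e)) → w≢y e
        (inj₂ (e , _)) → x≢y e)))

    score-flip-winner : score (flip x y x≢y R) n y ≡ suc (score R n y)
    score-flip-winner = ∑-step n x<n
      (trans (cong toℕ (trans (flip-same (inj₂ (refl , refl))) (cong not y→x))) (cong (λ b → suc (toℕ b)) (sym y→x)))
      (λ w w≢x → cong toℕ (flip-other λ where
        (inj₁ (e , _)) → x≢y (sym e)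
        (inj₂ (_ , e)) → w≢x e))
      where
      y→x : beats R y x ≡ false
      y→x = trans (total R (≢-sym x≢y)) (cong not x→y)

    score-flip-other : ∀ {u} → u ≢ x → u ≢ y → score (flip x y x≢y R) n u ≡ score R n u
    score-flip-other u≢x u≢y = ∑-cong n (λ w _ → cong toℕ (flip-other λ where
      (inj₁ (e , _)) → u≢x e
      (inj₂ (e , _)) → u≢y e))

record Transfer (n x y : ℕ) (R R′ : Tournament) : Set where
  field
    giver : score R n x ≡ suc (score R′ n x)
    taker : score R′ n y ≡ suc (score R n y)
    rest  : ∀ u → u ≢ x → u ≢ y → score R′ n u ≡ score R n u

-- If x beats y, reverse that arc. Otherwise the larger score of x yields a vertex z beaten by x but
-- not by y; then z beats y, and the path x, z, y is reversed.
transfer : ∀ R n {x y} → x < n → y < n → score R n y < score R n x → ∃ λ R′ → Transfer n x y R R′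
transfer R n {x} {y} x<n y<n lt with x ≟ y
... | yes refl = ⊥-elim (<-irrefl refl lt)
... | no x≢y with beats R x y in x→y
...   | true = flip x y x≢y R , record
          { giver = score-flip-loser R x≢y x<n y<n x→y
          ; taker = score-flip-winner R x≢y x<n y<n x→y
          ; rest  = λ u u≢x u≢y → score-flip-other R x≢y x<n y<n x→y u≢x u≢y }
...   | false with anyUpTo? (λ z → beats R x z Bool.≟ true ×-dec beats R y z Bool.≟ false) n
...     | no none = ⊥-elim (<⇒≱ lt (∑-mono n λ z z<n → le z λ p → none (z , z<n , p)))
  where
  le : ∀ z → ¬ (beats R x z ≡ true × beats R y z ≡ false) → toℕ (beats R x z) ≤ toℕ (beats R y z)
  le z ¬p with beats R x z | beats R y z
  ... | false | _     = z≤n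
  ... | true  | true  = ≤-refl
  ... | true  | false = ⊥-elim (¬p (refl , refl))
...     | yes (z , z<n , x→z , y↛z) = R₂ , record
          { giver = trans (score-flip-loser R x≢z x<n z<n x→z)
                          (cong suc (sym (score-flip-other R₁ z≢y z<n y<n z→y x≢z x≢y)))
          ; taker = trans (score-flip-winner R₁ z≢y z<n y<n z→y)
                          (cong suc (score-flip-other R x≢z x<n z<n x→z (≢-sym x≢y) (≢-sym z≢y)))
          ; rest  = rest′ }
  where
  x≢z : x ≢ z
  x≢z refl with () ← trans (sym x→z) (irrefl R x)
  z≢y : z ≢ y
  z≢y refl with () ← trans (sym x→z) x→y
  R₁ = flip x z x≢z R
  z→y : beats R₁ z y ≡ true
  z→y = trans (flip-other R x≢z λ { (inj₁ (e , _)) → x≢z (sym e) ; (inj₂ (_ , e)) → x≢y (sym e) })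
              (trans (total R z≢y) (cong not y↛z))
  R₂ = flip z y z≢y R₁
  rest′ : ∀ u → u ≢ x → u ≢ y → score R₂ n u ≡ score R n u
  rest′ u u≢x u≢y with u ≟ z
  -- The intermediate vertex gains one from the first reversal and loses one in the second.
  ... | yes refl = suc-injective (trans (sym (score-flip-loser R₁ z≢y z<n y<n z→y))
                                        (score-flip-winner R x≢z x<n z<n x→z))
  ... | no u≢z = trans (score-flip-other R₁ z≢y z<n y<n z→y u≢z u≢y)
                       (score-flip-other R x≢z x<n z<n x→z u≢x u≢z)

module _ (n : ℕ) (t : ℕ → ℕ) where

  -- The invariant that keeps `transfer` applicable: for x above and y below target it gives score
  -- of y < t y ≤ t x < score of x.
  Monotone : Tournament → Set
  Monotone R = ∀ {x y} → x < n → y < n → t x < score R n x → score R n y < t y → t y ≤ t x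

  -- Truncated subtraction counts only the surplus over the targets, so raising a vertex that is
  -- below its target costs nothing.
  excess : Tournament → ℕ
  excess R = ∑ n (λ x → score R n x ∸ t x)

  -- As long as some vertex is above its target, equality of the totals provides another one below,
  -- and a transfer between them lowers `excess`. Once none is above, equality of the totals forces
  -- equality everywhere.
  ∃-tournament-with-scores : ∑ n t ≡ tri n → ∀ R → Monotone R →
    ∃ λ R′ → ∀ x → x < n → score R′ n x ≡ t x
  ∃-tournament-with-scores ∑t R mono = go R (<-wellFounded _) mono
    where
    go : ∀ R → Acc _<_ (excess R) → Monotone R → ∃ λ R′ → ∀ x → x < n → score R′ n x ≡ t x
    go R (acc rec) mono with anyUpTo? (λ x → t x <? score R n x) n
    ... | no none = R , ∑-≡-of-≤ n (λ x x<n → ≮⇒≥ λ p → none (x , x<n , p)) (trans (∑-score R n) (sym ∑t))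
    ... | yes (x , x<n , over) with anyUpTo? (λ y → score R n y <? t y) n
    ...   | no none = ⊥-elim (<-irrefl (trans ∑t (sym (∑-score R n)))
                          (∑-strict n (λ y y<n → ≮⇒≥ λ p → none (y , y<n , p)) x<n over))
    ...   | yes (y , y<n , under) with R′ , tr ← transfer R n x<n y<n
                                        (<-trans under (≤-<-trans (mono x<n y<n over under) over))
      = go R′ (rec smaller) mono′
      where
      open Transfer tr
      x≢y : x ≢ y
      x≢y refl = <-asym over under
      over-x : t x ≤ score R′ n x
      over-x = ≤-pred (subst (t x <_) giver over)
      under-y : score R′ n y ≤ t y
      under-y = subst (_≤ t y) (sym taker) under
      ≤∸ : ∀ u → u < n → score R′ n u ∸ t u ≤ score R n u ∸ t u
      ≤∸ u u<n with u ≟ x | u ≟ y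
      ... | yes refl | _ = ∸-monoˡ-≤ (t u) (subst (score R′ n u ≤_) (sym giver) (n≤1+n _))
      ... | no _ | yes refl = subst (_≤ score R n u ∸ t u) (sym (m≤n⇒m∸n≡0 under-y)) z≤n
      ... | no u≢x | no u≢y = ≤-reflexive (cong (_∸ t u) (rest u u≢x u≢y))
      smaller : excess R′ < excess R
      smaller = ∑-strict n ≤∸ x<n
        (subst (λ s → score R′ n x ∸ t x < s ∸ t x) (sym giver) (∸-monoˡ-< (n<1+n _) over-x))
      over⁻ : ∀ {u} → t u < score R′ n u → u ≢ y → t u < score R n u
      over⁻ {u} o u≢y with u ≟ x
      ... | yes refl = over
      ... | no u≢x = subst (t u <_) (rest u u≢x u≢y) o
      under⁻ : ∀ {u} → score R′ n u < t u → u ≢ x → score R n u < t u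
      under⁻ {u} o u≢x with u ≟ y
      ... | yes refl = under
      ... | no u≢y = subst (_< t u) (rest u u≢x u≢y) o
      -- No vertex moves above or below its target anew: `x` stays at or above, `y` at or below, and
      -- all other scores are unchanged.
      mono′ : Monotone R′
      mono′ u<n w<n o o′ = mono u<n w<n (over⁻ o λ { refl → <⇒≱ o under-y })
                                        (under⁻ o′ λ { refl → <⇒≱ o′ over-x })

-- Parity, residues modulo 4 and tournaments with even scores

odd : ℕ → Bool
odd zero    = false
odd (suc n) = not (odd n)

odd-+ : ∀ m n → odd (m + n) ≡ odd m xor odd n
odd-+ zero    n = refl
odd-+ (suc m) n = trans (cong not (odd-+ m n)) (lemma (odd m) (odd n))
  where
  lemma : ∀ a b → not (a xor b) ≡ not a xor b
  lemma false b = refl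
  lemma true  b = Bool.not-involutive b

even⇒2* : ∀ n → odd n ≡ false → ∃ λ q → n ≡ q * 2
even⇒2* zero          _ = 0 , refl
even⇒2* (suc (suc n)) e with q , eq ← even⇒2* n (trans (sym (Bool.not-involutive (odd n))) e) =
  suc q , cong (λ z → suc (suc z)) eq

odd-*2 : ∀ q → odd (q * 2) ≡ false
odd-*2 zero    = refl
odd-*2 (suc q) = trans (Bool.not-involutive _) (odd-*2 q)

-- Four more vertices bring 4n + 6 more edges, an even number. Hence the parity of `tri` has period
-- 4 and is decided by n = 0, 1, 2, 3.
odd-tri : ∀ n → odd (tri (4 + n)) ≡ odd (tri n)
odd-tri n =
  trans (cong odd (lemma (tri n) n))
    (trans (odd-+ (tri n) ((2 * n + 3) * 2))
      (trans (cong (odd (tri n) xor_) (odd-*2 (2 * n + 3))) (Bool.xor-identityʳ _)))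
  where
  lemma : ∀ t n → t + n + (1 + n) + (2 + n) + (3 + n) ≡ t + (2 * n + 3) * 2
  lemma = solve-∀

4+n%4 : ∀ n → (4 + n) % 4 ≡ n % 4
4+n%4 n = trans (cong (_% 4) (+-comm 4 n)) ([m+n]%n≡m%n n 4)

%4⇒tri-even : ∀ n → n % 4 ≡ 0 ⊎ n % 4 ≡ 1 → odd (tri n) ≡ false
%4⇒tri-even 0 _ = refl
%4⇒tri-even 1 _ = refl
%4⇒tri-even 2 (inj₁ ())
%4⇒tri-even 2 (inj₂ ())
%4⇒tri-even 3 (inj₁ ())
%4⇒tri-even 3 (inj₂ ())
%4⇒tri-even (suc (suc (suc (suc n)))) h =
  trans (odd-tri n) (%4⇒tri-even n (subst (λ z → z ≡ 0 ⊎ z ≡ 1) (4+n%4 n) h))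

tri-even⇒%4 : ∀ n → odd (tri n) ≡ false → n % 4 ≡ 0 ⊎ n % 4 ≡ 1
tri-even⇒%4 0 _ = inj₁ refl
tri-even⇒%4 1 _ = inj₂ refl
tri-even⇒%4 2 ()
tri-even⇒%4 3 ()
tri-even⇒%4 (suc (suc (suc (suc n)))) h =
  subst (λ z → z ≡ 0 ⊎ z ≡ 1) (sym (4+n%4 n)) (tri-even⇒%4 n (trans (sym (odd-tri n)) h))

∑-even : ∀ n {f} → (∀ x → x < n → odd (f x) ≡ false) → odd (∑ n f) ≡ false
∑-even zero        _ = refl
∑-even (suc n) {f} e =
  trans (odd-+ (∑ n f) (f n)) (cong₂ _xor_ (∑-even n λ x x<n → e x (m<n⇒m<1+n x<n)) (e n (n<1+n n)))

-- Not joined by an edge of the Hamiltonian path 0, 1, 2, ..., whose edges are the only ones that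
-- `evenScores` may reverse.
Apart : ℕ → ℕ → Set
Apart x y = y ≢ suc x × x ≢ suc y

-- Reversing the edge between i and i + 1 affects no score but those of its ends, so the vertices
-- below i, already settled, keep their even scores.
evenScores : ∀ n → n % 4 ≡ 0 ⊎ n % 4 ≡ 1 → ∀ R →
  ∃ λ R′ → (∀ x → x < n → odd (score R′ n x) ≡ false) ×
           (∀ {x y} → Apart x y → beats R′ x y ≡ beats R x y)
evenScores zero    _ R = R , (λ _ ()) , λ _ → refl
evenScores (suc m) h R = let R′ , even , agree = go m ≤-refl in R′ , complete R′ even , agree
  where
  n = suc m
  complete : ∀ R′ → (∀ x → x < m → odd (score R′ n x) ≡ false) → ∀ x → x < n → odd (score R′ n x) ≡ false
  complete R′ even x x<n with m<1+n⇒m<n∨m≡n x<n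
  ... | inj₁ x<m  = even x x<m
  ... | inj₂ refl = trans (cong (_xor odd (score R′ n m)) (sym (∑-even m even)))
                      (trans (sym (odd-+ (∑ m (score R′ n)) (score R′ n m)))
                        (trans (cong odd (∑-score R′ n)) (%4⇒tri-even n h)))
  EvenBelow : ℕ → Set
  EvenBelow i = ∃ λ R′ → (∀ x → x < i → odd (score R′ n x) ≡ false) ×
                         (∀ {x y} → Apart x y → beats R′ x y ≡ beats R x y)
  go : ∀ i → i ≤ m → EvenBelow i
  go zero    _   = R , (λ _ ()) , λ _ → refl
  go (suc i) i<m with R₁ , even , agree ← go i (<⇒≤ i<m) | odd (score R₁ n i) in parity
  ... | false = R₁ , even′ , agree
    where
    even′ : ∀ x → x < suc i → odd (score R₁ n x) ≡ false
    even′ x x<1+i with m<1+n⇒m<n∨m≡n x<1+i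
    ... | inj₁ x<i  = even x x<i
    ... | inj₂ refl = parity
  ... | true  = case (beats R₁ i (suc i)) refl
    where
    i<n : i < n
    i<n = m<n⇒m<1+n i<m
    1+i<n : suc i < n
    1+i<n = s≤s i<m
    -- Whichever way the edge points, its reversal changes the score of `i` by one and so corrects
    -- its parity.
    case : ∀ b → beats R₁ i (suc i) ≡ b → EvenBelow (suc i)
    case true i→ = R₂ , even′ , agree′
      where
      i≢ : i ≢ suc i
      i≢ = ≢-sym 1+n≢n
      R₂ = flip i (suc i) i≢ R₁
      even′ : ∀ x → x < suc i → odd (score R₂ n x) ≡ false
      even′ x x<1+i with m<1+n⇒m<n∨m≡n x<1+i
      ... | inj₁ x<i  = trans (cong odd (score-flip-other R₁ i≢ i<n 1+i<n i→ (<⇒≢ x<i) (<⇒≢ x<1+i))) (even x x<i)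
      ... | inj₂ refl = trans (sym (Bool.not-involutive _))
                          (cong not (trans (cong odd (sym (score-flip-loser R₁ i≢ i<n 1+i<n i→))) parity))
      agree′ : ∀ {x y} → Apart x y → beats R₂ x y ≡ beats R x y
      agree′ a@(p , q) = trans (flip-other R₁ i≢ λ { (inj₁ (refl , refl)) → p refl ; (inj₂ (refl , refl)) → q refl }) (agree a)
    case false i↛ = R₂ , even′ , agree′
      where
      ≢i : suc i ≢ i
      ≢i = 1+n≢n
      →i : beats R₁ (suc i) i ≡ true
      →i = trans (total R₁ ≢i) (cong not i↛)
      R₂ = flip (suc i) i ≢i R₁
      even′ : ∀ x → x < suc i → odd (score R₂ n x) ≡ false
      even′ x x<1+i with m<1+n⇒m<n∨m≡n x<1+i
      ... | inj₁ x<i  = trans (cong odd (score-flip-other R₁ ≢i 1+i<n i<n →i (<⇒≢ x<1+i) (<⇒≢ x<i))) (even x x<i)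
      ... | inj₂ refl = trans (cong odd (score-flip-winner R₁ ≢i 1+i<n i<n →i)) (cong not parity)
      agree′ : ∀ {x y} → Apart x y → beats R₂ x y ≡ beats R x y
      agree′ a@(p , q) = trans (flip-other R₁ ≢i λ { (inj₁ (refl , refl)) → q refl ; (inj₂ (refl , refl)) → p refl }) (agree a)

-- Counting with duplicate-free lists

module _ {A : Set} where

  unique∧set⇒length : ∀ {xs ys : List A} → Unique xs → Unique ys → xs ⊆ ys → ys ⊆ xs → length xs ≡ length ys
  unique∧set⇒length xs! ys! xs⊆ys ys⊆xs = ↭-length (∼bag⇒↭ (unique∧set⇒bag xs! ys! (mk⇔ xs⊆ys ys⊆xs)))

module _ {A B : Set} (g : A → List B) where

  concatMap-unique : ∀ {xs} → Unique xs → (∀ {x} → x ∈ xs → Unique (g x)) →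
    (∀ {x y z} → z ∈ g x → z ∈ g y → x ≡ y) → Unique (concatMap g xs)
  concatMap-unique {[]} _ _ _ = []
  concatMap-unique {x ∷ xs} xs!@(_ ∷ tl) g! disj =
    Unique.++⁺ (g! (here refl)) (concatMap-unique tl (λ x∈ → g! (there x∈)) disj) λ (z∈ , z∈′) →
      let y , y∈ , z∈gy = find (∈-concatMap⁻ g {xs = xs} z∈′) in
      Unique.Unique[x∷xs]⇒x∉xs xs! (subst (_∈ xs) (sym (disj z∈ z∈gy)) y∈)

  length-concatMap : ∀ xs {ℓ} → (∀ {x} → x ∈ xs → length (g x) ≡ ℓ) → length (concatMap g xs) ≡ length xs * ℓ
  length-concatMap []       _  = refl
  length-concatMap (x ∷ xs) eq = trans (length-++ (g x))
    (cong₂ _+_ (eq (here refl)) (length-concatMap xs (λ x∈ → eq (there x∈))))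

  ∈-concatMap : ∀ {xs x z} → x ∈ xs → z ∈ g x → z ∈ concatMap g xs
  ∈-concatMap x∈ z∈ = ∈-concatMap⁺ g (lose x∈ z∈)

  concatMap-∈ : ∀ {xs z} → z ∈ concatMap g xs → ∃ λ x → x ∈ xs × z ∈ g x
  concatMap-∈ {xs} z∈ = find (∈-concatMap⁻ g {xs = xs} z∈)

module _ {A B : Set} where

  -- With `others` this lists the ordered pairs of distinct points, with `leaves` the pairs of a
  -- centre and a leaf set.
  fibred : (A → List B) → List A → List (A × B)
  fibred f = concatMap (λ x → map (x ,_) (f x))

  ∈-fibred⁺ : ∀ f {xs x y} → x ∈ xs → y ∈ f x → (x , y) ∈ fibred f xs
  ∈-fibred⁺ f x∈ y∈ = ∈-concatMap _ x∈ (∈-map⁺ _ y∈)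

  ∈-fibred⁻ : ∀ f {xs x y} → (x , y) ∈ fibred f xs → x ∈ xs × y ∈ f x
  ∈-fibred⁻ f z∈ with x , x∈ , z∈′ ← concatMap-∈ (λ x → map (x ,_) (f x)) z∈ with _ , y∈ , refl ← ∈-map⁻ (x ,_) z∈′ = x∈ , y∈

  fibred-unique : ∀ {f xs} → Unique xs → (∀ {x} → x ∈ xs → Unique (f x)) → Unique (fibred f xs)
  fibred-unique xs! f! = concatMap-unique _ xs! (λ x∈ → Unique.map⁺ (λ { refl → refl }) (f! x∈)) disj
    where
    disj : ∀ {x y : A} {z} {ys ys′ : List B} → z ∈ map (x ,_) ys → z ∈ map (y ,_) ys′ → x ≡ y
    disj {x} {y} p q with _ , _ , refl ← ∈-map⁻ (x ,_) p with _ , _ , refl ← ∈-map⁻ (y ,_) q = refl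

  length-fibred : ∀ f xs {ℓ} → (∀ {x} → x ∈ xs → length (f x) ≡ ℓ) → length (fibred f xs) ≡ length xs * ℓ
  length-fibred f xs eq = length-concatMap _ xs (λ {x} x∈ → trans (length-map (x ,_) (f x)) (eq x∈))

infixl 6 _∖_

_∖_ : List ℕ → List ℕ → List ℕ
ys ∖ xs = filter (λ y → ¬? (y ∈? xs)) ys

length-∖ : ∀ {xs ys} → Unique xs → Unique ys → xs ⊆ ys → length ys ≡ length xs + length (ys ∖ xs)
length-∖ {xs} {ys} xs! ys! xs⊆ys = trans
  (unique∧set⇒length ys! (Unique.++⁺ xs! (Unique.filter⁺ _ ys!) λ (z∈ , z∈′) → proj₂ (∈-filter⁻ _ {xs = ys} z∈′) z∈)
    to from)
  (length-++ xs)
  where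
  to : ys ⊆ xs ++ (ys ∖ xs)
  to {z} z∈ with z ∈? xs
  ... | yes z∈xs = ∈-++⁺ˡ z∈xs
  ... | no z∉xs = ∈-++⁺ʳ xs (∈-filter⁺ _ z∈ z∉xs)
  from : xs ++ (ys ∖ xs) ⊆ ys
  from z∈ with ∈-++⁻ xs z∈
  ... | inj₁ z∈xs = xs⊆ys z∈xs
  ... | inj₂ z∈∖ = proj₁ (∈-filter⁻ _ {xs = ys} z∈∖)

-- Necessity

-- Both orientations of both edges, hence four entries for every block in the double count.
P₃-arcs : List (ℕ × ℕ)
P₃-arcs = (0 , 1) ∷ (1 , 0) ∷ (1 , 2) ∷ (2 , 1) ∷ []

P₃-arcs-unique : Unique P₃-arcs
P₃-arcs-unique = ((λ ()) ∷ (λ ()) ∷ (λ ()) ∷ []) ∷ ((λ ()) ∷ (λ ()) ∷ []) ∷ ((λ ()) ∷ []) ∷ [] ∷ []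

∈-P₃-arcs : ∀ {a b} → (a , b) ∈ P₃-arcs ⇔ Adj P₃ a b
∈-P₃-arcs = mk⇔ to from
  where
  to : ∀ {a b} → (a , b) ∈ P₃-arcs → Adj P₃ a b
  to (here refl) = s≤s z≤n , s≤s (s≤s z≤n) , inj₁ refl
  to (there (here refl)) = s≤s (s≤s z≤n) , s≤s z≤n , inj₂ refl
  to (there (there (here refl))) = s≤s (s≤s z≤n) , s≤s (s≤s (s≤s z≤n)) , inj₁ refl
  to (there (there (there (here refl)))) = s≤s (s≤s (s≤s z≤n)) , s≤s (s≤s z≤n) , inj₂ refl
  from : ∀ {a b} → Adj P₃ a b → (a , b) ∈ P₃-arcs
  from {0} (_ , _ , inj₁ refl) = here refl
  from {1} (_ , _ , inj₁ refl) = there (there (here refl))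
  from {suc (suc _)} (_ , s≤s (s≤s (s≤s ())) , inj₁ refl)
  from {_} {0} (_ , _ , inj₂ refl) = there (here refl)
  from {_} {1} (_ , _ , inj₂ refl) = there (there (there (here refl)))
  from {_} {suc (suc _)} (s≤s (s≤s (s≤s ())) , _ , inj₂ refl)

module _ {G : Graph} (iso : G ≅ P₃) where
  open _≅_ iso

  copy-arcs : List (ℕ × ℕ)
  copy-arcs = map (Product.map from from) P₃-arcs

  ∈-copy-arcs : ∀ {x y} → (x , y) ∈ copy-arcs ⇔ Adj G x y
  ∈-copy-arcs = mk⇔ fwd bwd
    where
    fwd : ∀ {x y} → (x , y) ∈ copy-arcs → Adj G x y
    fwd z∈ with (a , b) , ab∈ , refl ← ∈-map⁻ (Product.map from from) z∈ =
      let adj = ⇒ ∈-P₃-arcs ab∈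
          a∈ = adj-vertex P₃ adj
          b∈ = adj-vertex P₃ (symmetric P₃ {a} {b} adj)
      in ⇐ (adj⇔ (from-∈ a∈) (from-∈ b∈)) (subst₂ (Adj P₃) (sym (to-from a∈)) (sym (to-from b∈)) adj)
    bwd : ∀ {x y} → Adj G x y → (x , y) ∈ copy-arcs
    bwd adj =
      let x∈ = adj-vertex G adj
          y∈ = adj-vertex G (symmetric G adj)
      in subst₂ (λ u w → (u , w) ∈ copy-arcs) (from-to x∈) (from-to y∈)
           (∈-map⁺ (Product.map from from) (⇐ ∈-P₃-arcs (⇒ (adj⇔ x∈ y∈) adj)))

  -- The isomorphism carries the list back to `P₃-arcs`; a repetition here would become a repetition
  -- there.
  copy-arcs-unique : Unique copy-arcs
  copy-arcs-unique = Unique.map⁻ {f = Product.map to to} (subst Unique (sym back) P₃-arcs-unique)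
    where
    e : ∀ {a} → a < 3 → to (from a) ≡ a
    e a<3 = to-from (∈-upTo⁺ a<3)
    e₀ = e {0} (s≤s z≤n)
    e₁ = e {1} (s≤s (s≤s z≤n))
    e₂ = e {2} (s≤s (s≤s (s≤s z≤n)))
    back : map (Product.map to to) copy-arcs ≡ P₃-arcs
    back = cong₂ _∷_ (cong₂ _,_ e₀ e₁) (cong₂ _∷_ (cong₂ _,_ e₁ e₀)
          (cong₂ _∷_ (cong₂ _,_ e₁ e₂) (cong₂ _∷_ (cong₂ _,_ e₂ e₁) refl)))

others : List ℕ → ℕ → List ℕ
others xs x = xs ∖ (x ∷ [])

length-others : ∀ {xs x} → Unique xs → x ∈ xs → length (others xs x) ≡ length xs ∸ 1
length-others xs! x∈ = sym (cong (_∸ 1) (length-∖ ([] ∷ []) xs! λ { (here refl) → x∈ }))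

-- The ordered pairs of distinct points and the arcs of all blocks are duplicate-free lists of the
-- same set. Comparing lengths shows that the number of edges is twice the number of blocks, hence
-- even.
P₃-design-order : ∀ {n} → DesignOfOrder n P₃ → n % 4 ≡ 0 ⊎ n % 4 ≡ 1
P₃-design-order {n} 𝓓 = tri-even⇒%4 n (subst (λ t → odd t ≡ _) (sym tri≡) (odd-*2 (size D)))
  where
  open DesignOfOrder 𝓓 using () renaming (points to X; points-unique to X!; design to D)
  edges : List (ℕ × ℕ)
  edges = fibred (others X) X
  blocks : List (ℕ × ℕ)
  blocks = concatMap (λ i → copy-arcs (block≅Γ D i)) (allFin (size D))
  edges-unique : Unique edges
  edges-unique = fibred-unique X! λ _ → Unique.filter⁺ _ X!
  adj-K : ∀ {i x y} → Adj (block D i) x y → Adj (completeOn X X!) x y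
  adj-K = _⊑_.edges⊆ (block⊑K D _)
  blocks-unique : Unique blocks
  blocks-unique = concatMap-unique _ (Unique.allFin⁺ _) (λ {i} _ → copy-arcs-unique (block≅Γ D i)) λ {i} {j} p q →
    let p′ = ⇒ (∈-copy-arcs (block≅Γ D i)) p
        _ , _ , only = edges-partition D (adj-K p′)
    in trans (sym (only p′)) (only (⇒ (∈-copy-arcs (block≅Γ D j)) q))
  e⊆b : edges ⊆ blocks
  e⊆b {x , y} z∈ with x∈ , y∈ ← ∈-fibred⁻ (others X) z∈ with y∈X , y≢x ← ∈-filter⁻ _ {xs = X} y∈
    with i , adj , _ ← edges-partition D (x∈ , y∈X , λ { refl → y≢x (here refl) })
    = ∈-concatMap _ (∈-allFin i) (⇐ (∈-copy-arcs (block≅Γ D i)) adj)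
  b⊆e : blocks ⊆ edges
  b⊆e {x , y} z∈ with i , _ , z∈′ ← concatMap-∈ (λ i → copy-arcs (block≅Γ D i)) {xs = allFin (size D)} z∈
    with x∈ , y∈ , x≢y ← adj-K (⇒ (∈-copy-arcs (block≅Γ D i)) z∈′)
    = ∈-fibred⁺ (others X) x∈ (∈-filter⁺ _ y∈ λ { (here refl) → x≢y refl })
  count : n * (n ∸ 1) ≡ size D * 4
  count = trans (sym (trans (length-fibred (others X) X (length-others X!))
                            (cong₂ (λ a b → a * (b ∸ 1)) (order 𝓓) (order 𝓓))))
          (trans (unique∧set⇒length edges-unique blocks-unique e⊆b b⊆e)
          (trans (length-concatMap _ (allFin (size D)) (λ _ → refl)) (cong (_* 4) (length-tabulate {n = size D} (λ i → i)))))
  tri≡ : tri n ≡ size D * 2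
  tri≡ = *-cancelʳ-≡ (tri n) (size D * 2) 2 (trans (tri-*2 n) (trans count (sym (*-assoc (size D) 2 2))))

star-adj⇒centre : ∀ {k a b} → Adj (star k) a b → a ≡ 0 ⊎ b ≡ 0
star-adj⇒centre (inj₁ (s≤s z≤n , _)) = inj₁ refl
star-adj⇒centre (inj₂ (s≤s z≤n , _)) = inj₂ refl

module _ {k : ℕ} {G : Graph} (iso : G ≅ star k) where
  open _≅_ iso

  -- The part of size one of `star k` is {0}, so `from 0` is the centre of the copy.
  centre-of-edge : ∀ {x y} → Adj G x y → x ≡ from 0 ⊎ y ≡ from 0
  centre-of-edge adj with x∈ ← adj-vertex G adj | y∈ ← adj-vertex G (symmetric G adj)
    with star-adj⇒centre {k} (⇒ (adj⇔ x∈ y∈) adj)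
  ... | inj₁ e = inj₁ (trans (sym (from-to x∈)) (cong from e))
  ... | inj₂ e = inj₂ (trans (sym (from-to y∈)) (cong from e))

P₃-edge : ∀ {G} → G ≅ P₃ → ∃ λ x → ∃ λ y → Adj G x y
P₃-edge iso = from 0 , from 1 , ⇒ (∈-copy-arcs iso) (here refl)
  where open _≅_ iso

length≤1 : ∀ {xs : List ℕ} → Unique xs → (∀ {x y} → x ∈ xs → y ∈ xs → x ≡ y) → length xs ≤ 1
length≤1 {[]} _ _ = z≤n
length≤1 {_ ∷ []} _ _ = s≤s z≤n
length≤1 {_ ∷ _ ∷ _} ((x≢y ∷ _) ∷ _) eq = ⊥-elim (x≢y (eq (here refl) (there (here refl))))

downLink-order : ∀ {k v n} → 𝓛₁ (star k) v n → v ∸ 1 ≤ n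
downLink-order {k} {v} {n} (𝓑 , 𝓑′ , f , link) = m≤n+o⇒m∸n≤o v 1 v≤1+n
  where
  open DesignOfOrder 𝓑 using () renaming (points to X; points-unique to X!; design to D)
  open DesignOfOrder 𝓑′ using () renaming (points to X′; points-unique to X′!; design to D′)
  -- The edge xy and an edge pq of the linked path lie in the same star, so both contain its centre.
  -- That centre is a point of the path design because p and q are.
  touches : ∀ {x y} → x ∈ X → y ∈ X → x ≢ y → x ∈ X′ ⊎ y ∈ X′
  touches {x} {y} x∈ y∈ x≢y with i , adj , _ ← edges-partition D (x∈ , y∈ , x≢y)
    with p , q , adj′ ← P₃-edge (block≅Γ D′ (f i))
    with p∈ , q∈ , _ ← _⊑_.edges⊆ (block⊑K D′ (f i)) adj′
    with centre-of-edge (block≅Γ D i) adj | centre-of-edge (block≅Γ D i) (_⊑_.edges⊆ (link i) adj′)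
  ... | inj₁ refl | inj₁ refl = inj₁ p∈
  ... | inj₁ refl | inj₂ refl = inj₁ q∈
  ... | inj₂ refl | inj₁ refl = inj₂ p∈
  ... | inj₂ refl | inj₂ refl = inj₂ q∈
  missing : ∀ {x y} → x ∈ X ∖ X′ → y ∈ X ∖ X′ → x ≡ y
  missing {x} {y} x∈ y∈ with x∈X , x∉ ← ∈-filter⁻ _ {xs = X} x∈ | y∈X , y∉ ← ∈-filter⁻ _ {xs = X} y∈ with x ≟ y
  ... | yes e = e
  ... | no x≢y with touches x∈X y∈X x≢y
  ...   | inj₁ x∈X′ = ⊥-elim (x∉ x∈X′)
  ...   | inj₂ y∈X′ = ⊥-elim (y∉ y∈X′)
  common : List ℕ
  common = filter (_∈? X′) X
  common! : Unique common
  common! = Unique.filter⁺ _ X!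
  common≤n : length common ≤ n
  common≤n = subst (length common ≤_) (order 𝓑′) (subst (length common ≤_)
    (sym (length-∖ common! X′! λ z∈ → proj₂ (∈-filter⁻ (_∈? X′) {xs = X} z∈))) (m≤m+n _ _))
  ∖-common : X ∖ common ⊆ X ∖ X′
  ∖-common z∈ with z∈X , z∉ ← ∈-filter⁻ _ {xs = X} z∈ = ∈-filter⁺ _ z∈X λ z∈X′ → z∉ (∈-filter⁺ _ z∈X z∈X′)
  v≤1+n : v ≤ 1 + n
  v≤1+n = subst₂ _≤_ (trans (sym (length-∖ common! X! λ z∈ → proj₁ (∈-filter⁻ _ {xs = X} z∈))) (order 𝓑))
    (+-comm n 1)
    (+-mono-≤ common≤n (length≤1 (Unique.filter⁺ _ X!) λ x∈ y∈ → missing (∖-common x∈) (∖-common y∈)))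

-- Stars and star systems

module _ {A : Set} where

  unique-++⁻ : ∀ xs {ys : List A} → Unique (xs ++ ys) →
    Unique xs × Unique ys × (∀ {z} → z ∈ xs → z ∈ ys → ∀ {B : Set} → B)
  unique-++⁻ []       ys! = [] , ys! , λ ()
  unique-++⁻ (x ∷ xs) (x∉ ∷ u) with xs! , ys! , disj ← unique-++⁻ xs u =
    (All.tabulate (λ z∈ → All.lookup x∉ (∈-++⁺ˡ z∈))) ∷ xs! , ys! , disj′
    where
    disj′ : ∀ {z} → z ∈ x ∷ xs → z ∈ _ → ∀ {B : Set} → B
    disj′ (here refl) z∈ = ⊥-elim (All.lookup x∉ (∈-++⁺ʳ xs z∈) refl)
    disj′ (there z∈′) z∈ = disj z∈′ z∈

  same-part : ∀ {xss : List (List A)} → Unique (concat xss) → ∀ {xs ys z} →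
    xs ∈ xss → ys ∈ xss → z ∈ xs → z ∈ ys → xs ≡ ys
  same-part {xs ∷ xss} u (here refl)  (here refl)  _  _   = refl
  same-part {xs ∷ xss} u (here refl)  (there ys∈)  z∈ z∈′ = proj₂ (proj₂ (unique-++⁻ xs u)) z∈ (∈-concat⁺′ z∈′ ys∈)
  same-part {xs ∷ xss} u (there xs∈)  (here refl)  z∈ z∈′ = proj₂ (proj₂ (unique-++⁻ xs u)) z∈′ (∈-concat⁺′ z∈ xs∈)
  same-part {xs ∷ xss} u (there xs∈)  (there ys∈)  z∈ z∈′ = same-part (proj₁ (proj₂ (unique-++⁻ xs u))) xs∈ ys∈ z∈ z∈′

  -- A repeated nonempty part would repeat one of its elements in the concatenation.
  parts-unique : ∀ {xss : List (List A)} → Unique (concat xss) → (∀ {xs} → xs ∈ xss → ∃ λ z → z ∈ xs) → Unique xss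
  parts-unique {[]}       _ _  = []
  parts-unique {xs ∷ xss} u ne with _ , u′ , disj ← unique-++⁻ xs u with z , z∈ ← ne (here refl) =
    ¬Any⇒All¬ xss (λ xs∈ → disj z∈ (∈-concat⁺′ z∈ xs∈)) ∷ parts-unique u′ (λ xs∈ → ne (there xs∈))

  part-unique : ∀ {xss : List (List A)} → Unique (concat xss) → ∀ {xs} → xs ∈ xss → Unique xs
  part-unique {xs ∷ _} u (here refl) = proj₁ (unique-++⁻ xs u)
  part-unique {xs ∷ _} u (there xs∈) = part-unique (proj₁ (proj₂ (unique-++⁻ xs u))) xs∈

  lookup-injective : ∀ {xs : List A} → Unique xs → ∀ {i j} → lookup xs i ≡ lookup xs j → i ≡ j
  lookup-injective {_ ∷ _}  _        {Fin.zero}  {Fin.zero}  _  = refl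
  lookup-injective {_ ∷ xs} (x∉ ∷ _) {Fin.zero}  {Fin.suc j} eq = ⊥-elim (All.lookup x∉ (∈-lookup j) eq)
  lookup-injective {_ ∷ xs} (x∉ ∷ _) {Fin.suc i} {Fin.zero}  eq = ⊥-elim (All.lookup x∉ (∈-lookup i) (sym eq))
  lookup-injective {_ ∷ _}  (_ ∷ u)  {Fin.suc i} {Fin.suc j} eq = cong Fin.suc (lookup-injective u eq)

starGraph : ∀ c L → Unique (c ∷ L) → Graph
starGraph c L u = record
  { vertices   = c ∷ L
  ; unique     = u
  ; Adj        = λ x y → (x ≡ c × y ∈ L) ⊎ (y ≡ c × x ∈ L)
  ; adj?       = λ x y → (x ≟ c ×-dec y ∈? L) ⊎-dec (y ≟ c ×-dec x ∈? L)
  ; symmetric  = swap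
  ; loopless   = λ { refl (inj₁ (refl , c∈L)) → Unique.Unique[x∷xs]⇒x∉xs u c∈L
                   ; refl (inj₂ (refl , c∈L)) → Unique.Unique[x∷xs]⇒x∉xs u c∈L }
  ; adj-vertex = λ { (inj₁ (refl , _)) → here refl ; (inj₂ (_ , x∈L)) → there x∈L }
  }

-- Both functions return 0 outside their intended range.
position : List ℕ → ℕ → ℕ
position []       x = 0
position (z ∷ zs) x with x ≟ z
... | yes _ = 0
... | no  _ = suc (position zs x)

nth : List ℕ → ℕ → ℕ
nth []       _       = 0
nth (z ∷ zs) zero    = z
nth (z ∷ zs) (suc i) = nth zs i

position-< : ∀ {zs x} → x ∈ zs → position zs x < length zs
position-< {z ∷ zs} {x} x∈ with x ≟ z
... | yes _ = s≤s z≤n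
position-< {z ∷ zs} (here x≡z)  | no x≢z = ⊥-elim (x≢z x≡z)
position-< {z ∷ zs} (there x∈)  | no _   = s≤s (position-< x∈)

nth-position : ∀ {zs x} → x ∈ zs → nth zs (position zs x) ≡ x
nth-position {z ∷ zs} {x} x∈ with x ≟ z
... | yes x≡z = sym x≡z
nth-position {z ∷ zs} (here x≡z)  | no x≢z = ⊥-elim (x≢z x≡z)
nth-position {z ∷ zs} (there x∈)  | no _   = nth-position x∈

nth-∈ : ∀ {zs i} → i < length zs → nth zs i ∈ zs
nth-∈ {_ ∷ _} {zero}  _         = here refl
nth-∈ {_ ∷ _} {suc _} (s≤s i<n) = there (nth-∈ i<n)

position-nth : ∀ {zs i} → Unique zs → i < length zs → position zs (nth zs i) ≡ i
position-nth {z ∷ zs} {zero} _ _ with z ≟ z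
... | yes _  = refl
... | no z≢z = ⊥-elim (z≢z refl)
position-nth {z ∷ zs} {suc i} (z∉ ∷ u) (s≤s i<n) with nth zs i ≟ z
... | yes e = ⊥-elim (All.lookup z∉ (nth-∈ i<n) (sym e))
... | no _  = cong suc (position-nth u i<n)

nth-injective : ∀ {zs i j} → Unique zs → i < length zs → j < length zs → nth zs i ≡ nth zs j → i ≡ j
nth-injective {zs} u i< j< e = trans (sym (position-nth u i<)) (trans (cong (position zs) e) (position-nth u j<))

-- An enumeration of the vertices identifies them with their indices, leaving adjacency to be
-- checked on indices only. `V` may order the vertices differently from `vertices G`.
≅-by-enumeration : ∀ {G H V} → Unique V → vertices H ≡ upTo (length V) → vertices G ⊆ V → V ⊆ vertices G →
  (∀ {i j} → i < length V → j < length V → Adj G (nth V i) (nth V j) ⇔ Adj H i j) → G ≅ H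
≅-by-enumeration {G} {H} {V} V! H≡ G⊆V V⊆G adj = record
  { to      = position V
  ; from    = nth V
  ; to-∈    = λ x∈ → subst (_ ∈_) (sym H≡) (∈-upTo⁺ (position-< (G⊆V x∈)))
  ; from-∈  = λ y∈ → V⊆G (nth-∈ (bound y∈))
  ; from-to = λ x∈ → nth-position (G⊆V x∈)
  ; to-from = λ y∈ → position-nth V! (bound y∈)
  ; adj⇔    = λ {x} {y} x∈ y∈ → subst₂ (λ u w → Adj G u w ⇔ Adj H (position V x) (position V y))
                (nth-position (G⊆V x∈)) (nth-position (G⊆V y∈)) (adj (position-< (G⊆V x∈)) (position-< (G⊆V y∈)))
  }
  where
  bound : ∀ {y} → y ∈ vertices H → y < length V
  bound y∈ = ∈-upTo⁻ (subst (_ ∈_) H≡ y∈)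

starGraph≅star : ∀ {c L} u → starGraph c L u ≅ star (length L)
starGraph≅star {c} {L} u = ≅-by-enumeration u refl (λ x∈ → x∈) (λ x∈ → x∈) λ i< j< →
  mk⇔ (λ { (inj₁ e) → inj₁ (to i< j< e) ; (inj₂ e) → inj₂ (to j< i< e) })
      (λ { (inj₁ e) → inj₁ (from e) ; (inj₂ e) → inj₂ (from e) })
  where
  V = c ∷ L
  Cross : ℕ → ℕ → Set
  Cross i j = i < 1 × 1 ≤ j × j < suc (length L)
  to : ∀ {i j} → i < length V → j < length V → nth V i ≡ c × nth V j ∈ L → Cross i j
  to {i} {zero}  i< j< (_ , c∈L) = ⊥-elim (Unique.Unique[x∷xs]⇒x∉xs u c∈L)
  to {i} {suc j} i< j< (e , _) with refl ← nth-injective u i< (s≤s z≤n) e = s≤s z≤n , s≤s z≤n , j<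
  from : ∀ {i j} → Cross i j → nth V i ≡ c × nth V j ∈ L
  from (s≤s z≤n , s≤s {n = j} z≤n , s≤s j<) = refl , nth-∈ j<

starGraph≅P₃ : ∀ {c L} u → length L ≡ 2 → starGraph c L u ≅ P₃
starGraph≅P₃ {c} {a ∷ b ∷ []} u@((c≢a ∷ c≢b ∷ []) ∷ (a≢b ∷ []) ∷ _) refl =
  ≅-by-enumeration V! refl (λ { (here e) → there (here e)
                              ; (there (here e)) → here e
                              ; (there (there (here e))) → there (there (here e)) })
                           (λ { (here e) → there (here e)
                              ; (there (here e)) → here e
                              ; (there (there (here e))) → there (there (here e)) })
    λ i< j< → mk⇔ (λ { (inj₁ e) → to i< j< e
                     ; (inj₂ e) → symmetric P₃ {_} {_} (to j< i< e) })
                  (λ adj → from (⇐ ∈-P₃-arcs adj))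
  where
  -- The centre is listed second because 1 is the middle vertex of `P₃`.
  V = a ∷ c ∷ b ∷ []
  V! : Unique V
  V! = (≢-sym c≢a ∷ a≢b ∷ []) ∷ (c≢b ∷ []) ∷ [] ∷ []
  to : ∀ {i j} → i < 3 → j < 3 → nth V i ≡ c × nth V j ∈ a ∷ b ∷ [] → Adj P₃ i j
  to {i} {j} i< j< (e , here e′)
    with refl ← nth-injective {i = i} {1} V! i< (s≤s (s≤s z≤n)) e
       | refl ← nth-injective {i = j} {0} V! j< (s≤s z≤n) e′ = i< , j< , inj₂ refl
  to {i} {j} i< j< (e , there (here e′))
    with refl ← nth-injective {i = i} {1} V! i< (s≤s (s≤s z≤n)) e
       | refl ← nth-injective {i = j} {2} V! j< (s≤s (s≤s (s≤s z≤n))) e′ = i< , j< , inj₁ refl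
  from : ∀ {i j} → (i , j) ∈ P₃-arcs → Adj (starGraph c (a ∷ b ∷ []) u) (nth V i) (nth V j)
  from (here refl) = inj₂ (refl , here refl)
  from (there (here refl)) = inj₁ (refl , here refl)
  from (there (there (here refl))) = inj₁ (refl , there (here refl))
  from (there (there (there (here refl)))) = inj₂ (refl , there (here refl))

starGraph-⊑ : ∀ {c c′ L L′ u u′} → c′ ≡ c → L′ ⊆ L → starGraph c′ L′ u′ ⊑ starGraph c L u
starGraph-⊑ refl L′⊆L = record
  { vertices⊆ = λ { (here e) → here e ; (there x∈) → there (L′⊆L x∈) }
  ; edges⊆    = λ { (inj₁ (e , y∈)) → inj₁ (e , L′⊆L y∈) ; (inj₂ (e , x∈)) → inj₂ (e , L′⊆L x∈) } }

-- A decomposition of the complete graph into stars, with each edge directed from the centre of its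
-- star to the leaf. `leaves c` splits the out-neighbourhood of c into the leaf sets of the stars
-- centred at c. Since `P₃` is a star with two leaves, both designs take this form.
record StarSystem (Γ : Graph) (n : ℕ) : Set where
  field
    tournament : Tournament
    leaves     : ℕ → List (List ℕ)
    disjoint   : ∀ {c} → c < n → Unique (concat (leaves c))
    sound      : ∀ {c y} → c < n → y ∈ concat (leaves c) → y < n × beats tournament c y ≡ true
    complete   : ∀ {c y} → c < n → y < n → beats tournament c y ≡ true → y ∈ concat (leaves c)
    shape      : ∀ {c L} u → c < n → L ∈ leaves c → starGraph c L u ≅ Γ
    nonempty   : ∀ {c L} → c < n → L ∈ leaves c → ∃ λ y → y ∈ L

  stars : List (ℕ × List ℕ)
  stars = fibred leaves (upTo n)

  ∈-stars⁺ : ∀ {c L} → c < n → L ∈ leaves c → (c , L) ∈ stars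
  ∈-stars⁺ c<n = ∈-fibred⁺ leaves (∈-upTo⁺ c<n)

  ∈-stars⁻ : ∀ {c L} → (c , L) ∈ stars → c < n × L ∈ leaves c
  ∈-stars⁻ s∈ with c∈ , L∈ ← ∈-fibred⁻ leaves s∈ = ∈-upTo⁻ c∈ , L∈

  arc : ∀ {c L y} → (c , L) ∈ stars → y ∈ L → y < n × beats tournament c y ≡ true
  arc s∈ y∈ with c<n , L∈ ← ∈-stars⁻ s∈ = sound c<n (∈-concat⁺′ y∈ L∈)

  arc-irrefl : ∀ {c L} → (c , L) ∈ stars → c ∉ L
  arc-irrefl s∈ c∈ with () ← trans (sym (irrefl tournament _)) (proj₂ (arc s∈ c∈))

  star-unique : ∀ {c L} → (c , L) ∈ stars → Unique (c ∷ L)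
  star-unique s∈ with c<n , L∈ ← ∈-stars⁻ s∈ =
    ¬Any⇒All¬ _ (arc-irrefl s∈) ∷ part-unique (disjoint c<n) L∈

  stars-unique : Unique stars
  stars-unique = fibred-unique (Unique.upTo⁺ n) λ c∈ → parts-unique (disjoint (∈-upTo⁻ c∈)) (nonempty (∈-upTo⁻ c∈))

  blockAt : ∀ i → Graph
  blockAt i = starGraph (proj₁ (lookup stars i)) (proj₂ (lookup stars i)) (star-unique (∈-lookup i))

  same-star : ∀ {c L L′ y} → (c , L) ∈ stars → (c , L′) ∈ stars → y ∈ L → y ∈ L′ → L ≡ L′
  same-star s∈ s∈′ y∈ y∈′ with c<n , L∈ ← ∈-stars⁻ s∈ | _ , L∈′ ← ∈-stars⁻ s∈′ =
    same-part (disjoint c<n) L∈ L∈′ y∈ y∈′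

  -- Two stars covering an edge from its opposite ends would direct it both ways.
  asym : ∀ {c L c′ L′} → (c , L) ∈ stars → (c′ , L′) ∈ stars → c ∈ L′ → c′ ∈ L → ∀ {B : Set} → B
  asym {c} {L} {c′} s∈ s∈′ c∈ c′∈ with c ≟ c′
  ... | yes refl = ⊥-elim (arc-irrefl s∈ c′∈)
  ... | no c≢c′ with () ← trans (sym (trans (total tournament c≢c′) (cong not (proj₂ (arc s∈′ c∈))))) (proj₂ (arc s∈ c′∈))

  block-unique : ∀ {i j x y} → Adj (blockAt i) x y → Adj (blockAt j) x y → i ≡ j
  block-unique {i} {j} p q = lookup-injective stars-unique (eq (∈-lookup i) (∈-lookup j) p q)
    where
    eq : ∀ {c L c′ L′ x y} → (c , L) ∈ stars → (c′ , L′) ∈ stars →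
         (x ≡ c × y ∈ L) ⊎ (y ≡ c × x ∈ L) → (x ≡ c′ × y ∈ L′) ⊎ (y ≡ c′ × x ∈ L′) → (c , L) ≡ (c′ , L′)
    eq s∈ s∈′ (inj₁ (refl , y∈)) (inj₁ (refl , y∈′)) = cong (_ ,_) (same-star s∈ s∈′ y∈ y∈′)
    eq s∈ s∈′ (inj₁ (refl , y∈)) (inj₂ (refl , x∈))  = asym s∈ s∈′ x∈ y∈
    eq s∈ s∈′ (inj₂ (refl , x∈)) (inj₁ (refl , y∈))  = asym s∈ s∈′ y∈ x∈
    eq s∈ s∈′ (inj₂ (refl , x∈)) (inj₂ (refl , x∈′)) = cong (_ ,_) (same-star s∈ s∈′ x∈ x∈′)

  indexOf : ∀ {c L} → (c , L) ∈ stars → Fin (length stars)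
  indexOf = Any.index

  adj-index : ∀ {c L y} (s∈ : (c , L) ∈ stars) → y ∈ L → Adj (blockAt (indexOf s∈)) c y
  adj-index s∈ y∈ = inj₁ (cong proj₁ (lookup-index s∈) , subst (λ s → _ ∈ proj₂ s) (lookup-index s∈) y∈)

  covering : ∀ {x y} → x < n → y < n → beats tournament x y ≡ true → ∃ λ i → Adj (blockAt i) x y
  covering x<n y<n x→y with L , y∈ , L∈ ← ∈-concat⁻′ (leaves _) (complete x<n y<n x→y) =
    indexOf (∈-stars⁺ x<n L∈) , adj-index (∈-stars⁺ x<n L∈) y∈

  covered : ∀ {x y} → x < n → y < n → x ≢ y → ∃ λ i → Adj (blockAt i) x y
  covered {x} {y} x<n y<n x≢y with beats tournament x y in x→y
  ... | true  = covering x<n y<n x→y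
  ... | false with i , adj ← covering y<n x<n (trans (total tournament (≢-sym x≢y)) (cong not x→y)) = i , swap adj

  blockAt⊑ : ∀ i → blockAt i ⊑ completeOn (upTo n) (Unique.upTo⁺ n)
  blockAt⊑ i = record { vertices⊆ = v ; edges⊆ = λ adj → v (adj-vertex B adj) , v (adj-vertex B (symmetric B adj)) , λ e → loopless B e adj }
    where
    B = blockAt i
    v : vertices B ⊆ upTo n
    v (here refl) = ∈-upTo⁺ (proj₁ (∈-stars⁻ (∈-lookup i)))
    v (there y∈)  = ∈-upTo⁺ (proj₁ (arc (∈-lookup i) y∈))

  starDesign : DesignOfOrder n Γ
  starDesign = record
    { points        = upTo n
    ; points-unique = Unique.upTo⁺ n
    ; order         = length-upTo n
    ; design        = record
      { size     = length stars
      ; block    = blockAt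
      ; block⊑K  = blockAt⊑
      ; block≅Γ  = λ i → let c<n , L∈ = ∈-stars⁻ (∈-lookup i) in shape _ c<n L∈
      -- Inclusion of one block in the other gives them a common edge, and an edge determines its
      -- block.
      ; distinct = λ {i} {j} i⊑j _ →
          let c<n , L∈ = ∈-stars⁻ (∈-lookup i)
              y , y∈   = nonempty c<n L∈
              adj : Adj (blockAt i) (proj₁ (lookup stars i)) y
              adj = inj₁ (refl , y∈)
          in block-unique {i} {j} adj (_⊑_.edges⊆ i⊑j adj)
      ; edges-partition = λ (x∈ , y∈ , x≢y) →
          let i , adj = covered (∈-upTo⁻ x∈) (∈-upTo⁻ y∈) x≢y
          in i , adj , λ {j} adj′ → block-unique {i} {j} adj adj′
      }
    }

-- Linking

outs : Tournament → ℕ → ℕ → List ℕ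
outs R n x = filter (λ y → beats R x y Bool.≟ true) (upTo n)

length-outs : ∀ R n x → length (outs R n x) ≡ score R n x
length-outs R n x = go n
  where
  go : ∀ n → length (outs R n x) ≡ score R n x
  go zero    = refl
  go (suc n) = trans (cong (λ ys → length (filter _ ys)) (sym (upTo-∷ʳ n)))
    (trans (cong length (filter-++ (λ y → beats R x y Bool.≟ true) (upTo n) (n ∷ [])))
      (trans (length-++ (outs R n x)) (cong₂ _+_ (go n) last)))
    where
    last : length (filter (λ y → beats R x y Bool.≟ true) (n ∷ [])) ≡ toℕ (beats R x n)
    last with beats R x n
    ... | true  = refl
    ... | false = refl

∈-outs⁺ : ∀ R {n x y} → y < n → beats R x y ≡ true → y ∈ outs R n x
∈-outs⁺ R y<n = ∈-filter⁺ _ (∈-upTo⁺ y<n)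

∈-outs⁻ : ∀ R {n x y} → y ∈ outs R n x → y < n × beats R x y ≡ true
∈-outs⁻ R {n} y∈ with y∈′ , x→y ← ∈-filter⁻ _ {xs = upTo n} y∈ = ∈-upTo⁻ y∈′ , x→y

outs-unique : ∀ R n x → Unique (outs R n x)
outs-unique R n x = Unique.filter⁺ _ (Unique.upTo⁺ n)

module _ {A : Set} where

  chunks : ℕ → ℕ → List A → List (List A)
  chunks k zero    xs = []
  chunks k (suc q) xs = take k xs ∷ chunks k q (drop k xs)

  concat-chunks : ∀ k q xs → length xs ≡ q * k → concat (chunks k q xs) ≡ xs
  concat-chunks k zero    []  _  = refl
  concat-chunks k (suc q) xs  eq = trans
    (cong (take k xs ++_) (concat-chunks k q (drop k xs)
      (trans (length-drop k xs) (trans (cong (_∸ k) eq) (m+n∸m≡n k (q * k))))))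
    (take++drop≡id k xs)

  length-chunk : ∀ k q xs → length xs ≡ q * k → ∀ {ys} → ys ∈ chunks k q xs → length ys ≡ k
  length-chunk k (suc q) xs eq (here refl) =
    trans (length-take k xs) (m≤n⇒m⊓n≡m (subst (k ≤_) (sym eq) (m≤m+n k (q * k))))
  length-chunk k (suc q) xs eq (there ys∈) = length-chunk k q (drop k xs)
    (trans (length-drop k xs) (trans (cong (_∸ k) eq) (m+n∸m≡n k (q * k)))) ys∈

  concat-map-⊆ : ∀ {f : List A → List A} → (∀ {xs} → f xs ⊆ xs) → ∀ xss → concat (map f xss) ⊆ concat xss
  concat-map-⊆ {f} f⊆ (xs ∷ xss) z∈ with ∈-++⁻ (f xs) z∈
  ... | inj₁ z∈xs = ∈-++⁺ˡ (f⊆ z∈xs)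
  ... | inj₂ z∈xss = ∈-++⁺ʳ xs (concat-map-⊆ f⊆ xss z∈xss)

  concat-map-unique : ∀ {f : List A → List A} → (∀ {xs} → f xs ⊆ xs) → (∀ {xs} → Unique xs → Unique (f xs)) →
    ∀ xss → Unique (concat xss) → Unique (concat (map f xss))
  concat-map-unique f⊆ f! []         _ = []
  concat-map-unique {f} f⊆ f! (xs ∷ xss) u with xs! , u′ , disj ← unique-++⁻ xs u =
    Unique.++⁺ (f! xs!) (concat-map-unique f⊆ f! xss u′) λ (z∈ , z∈′) → disj (f⊆ z∈) (concat-map-⊆ f⊆ xss z∈′)

  nonempty-length : ∀ {m} {xs : List A} → length xs ≡ suc m → ∃ λ y → y ∈ xs
  nonempty-length {xs = y ∷ _} _ = y , here refl

  take-⊆ : ∀ m (xs : List A) → take m xs ⊆ xs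
  take-⊆ (suc m) (x ∷ xs) (here e)   = here e
  take-⊆ (suc m) (x ∷ xs) (there z∈) = there (take-⊆ m xs z∈)

length-concat : ∀ {A : Set} {k} (xss : List (List A)) → (∀ {xs} → xs ∈ xss → length xs ≡ k) → length (concat xss) ≡ length xss * k
length-concat []         _  = refl
length-concat (xs ∷ xss) eq = trans (length-++ xs) (cong₂ _+_ (eq (here refl)) (length-concat xss λ xs∈ → eq (there xs∈)))

unique-⊆⇒length-≤ : ∀ {xs ys : List ℕ} → Unique xs → xs ⊆ ys → length xs ≤ length ys
unique-⊆⇒length-≤ {xs} {ys} xs! xs⊆ys = ≤-trans
  (≤-trans (m≤m+n _ _) (≤-reflexive (sym (length-∖ xs! (deduplicate-! _≟_ ys) λ z∈ → ∈-deduplicate⁺ _≟_ (xs⊆ys z∈)))))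
  (length-deduplicate _≟_ ys)

-- Each out-neighbourhood is cut into consecutive pieces of length `suc k`, one for each star; the
-- successor makes every piece nonempty.
tournament⇒starSystem : ∀ R v k (q : ℕ → ℕ) → (∀ c → c < v → score R v c ≡ q c * suc k) → StarSystem (star (suc k)) v
tournament⇒starSystem R v k q eq = record
  { tournament = R
  ; leaves     = λ c → chunks (suc k) (q c) (outs R v c)
  ; disjoint   = λ {c} c<v → subst Unique (sym (whole c c<v)) (outs-unique R v c)
  ; sound      = λ {c} c<v y∈ → ∈-outs⁻ R (subst (_ ∈_) (whole c c<v) y∈)
  ; complete   = λ {c} c<v y<v c→y → subst (_ ∈_) (sym (whole c c<v)) (∈-outs⁺ R y<v c→y)
  ; shape      = λ {c} {L} u c<v L∈ → subst (λ l → starGraph c L u ≅ star l) (size-L c<v L∈) (starGraph≅star u)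
  ; nonempty   = λ c<v L∈ → nonempty-length (size-L c<v L∈)
  }
  where
  len : ∀ c → c < v → length (outs R v c) ≡ q c * suc k
  len c c<v = trans (length-outs R v c) (eq c c<v)
  whole : ∀ c → c < v → concat (chunks (suc k) (q c) (outs R v c)) ≡ outs R v c
  whole c c<v = concat-chunks (suc k) (q c) (outs R v c) (len c c<v)
  size-L : ∀ {c L} → c < v → L ∈ chunks (suc k) (q c) (outs R v c) → length L ≡ suc k
  size-L {c} c<v L∈ = length-chunk (suc k) (q c) (outs R v c) (len c c<v) L∈

-- The leaves that a linked path at c may use: they are points of the path design even when n = v -
-- 1, and `evenScores` leaves their arcs from c alone.
Eligible : ℕ → ℕ → ℕ → Set
Eligible v c y = y < v ∸ 1 × Apart c y

eligible? : ∀ v c y → Dec (Eligible v c y)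
eligible? v c y = y <? v ∸ 1 ×-dec (¬? (y ≟ suc c) ×-dec ¬? (c ≟ suc y))

module _ {Γ : Graph} {v : ℕ} (S : StarSystem Γ v) where
  open StarSystem S

  -- The centre too must be a point of the path design when n = v - 1, so v - 1 may not be the
  -- centre of any star.
  Linkable : Set
  Linkable = ∀ {c L} → c < v → L ∈ leaves c → c < v ∸ 1 × 2 ≤ length (filter (eligible? v c) L)

  module Link {n : ℕ} (v∸1≤n : v ∸ 1 ≤ n) (n%4 : n % 4 ≡ 0 ⊎ n % 4 ≡ 1) (linkable : Linkable) where

    link : ℕ → List ℕ → List ℕ
    link c L = take 2 (filter (eligible? v c) L)

    link-∈ : ∀ {c L y} → y ∈ link c L → y ∈ L × Eligible v c y
    link-∈ {c} {L} y∈ = ∈-filter⁻ (eligible? v c) {xs = L} (take-⊆ 2 _ y∈)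

    length-link : ∀ {c L} → c < v → L ∈ leaves c → length (link c L) ≡ 2
    length-link {c} {L} c<v L∈ = trans (length-take 2 (filter (eligible? v c) L)) (m≤n⇒m⊓n≡m (proj₂ (linkable c<v L∈)))

    -- When n > v, the vertices from v on are points of the path design without stars, hence without
    -- linked paths.
    links : ℕ → List (List ℕ)
    links c with c <? v
    ... | yes _ = map (link c) (leaves c)
    ... | no _  = []

    link-∈-links : ∀ {c L} → c < v → L ∈ leaves c → link c L ∈ links c
    link-∈-links {c} c<v L∈ with c <? v
    ... | yes _   = ∈-map⁺ (link c) L∈
    ... | no c≮v = ⊥-elim (c≮v c<v)

    links-unique : ∀ c → Unique (concat (links c))
    links-unique c with c <? v
    ... | yes c<v = concat-map-unique {f = link c} (λ y∈ → proj₁ (link-∈ y∈))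
                      (λ u → Unique.take⁺ 2 (Unique.filter⁺ (eligible? v c) u)) (leaves c) (disjoint c<v)
    ... | no _    = []

    ∈-links⁻ : ∀ {c P} → P ∈ links c → c < v × ∃ λ L → L ∈ leaves c × P ≡ link c L
    ∈-links⁻ {c} P∈ with c <? v
    ... | yes c<v = c<v , ∈-map⁻ (link c) P∈
    ∈-links⁻ {c} () | no _

    length-links : ∀ {c P} → P ∈ links c → length P ≡ 2
    length-links P∈ with c<v , L , L∈ , refl ← ∈-links⁻ P∈ = length-link c<v L∈

    even : ∃ λ R → (∀ x → x < n → odd (score R n x) ≡ false) ×
                   (∀ {x y} → Apart x y → beats R x y ≡ beats tournament x y)
    even = evenScores n n%4 tournament

    R′ : Tournament
    R′ = proj₁ even

    -- Eligible leaves are `Apart` from the centre, so these arcs have the same direction in `R′` as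
    -- in the star system.
    links-sound : ∀ {c y} → y ∈ concat (links c) → y < n × beats R′ c y ≡ true
    links-sound {c} y∈ with P , y∈P , P∈ ← ∈-concat⁻′ (links c) y∈
      with c<v , L , L∈ , refl ← ∈-links⁻ P∈
      with y∈L , y<v∸1 , apart ← link-∈ y∈P =
      <-≤-trans y<v∸1 v∸1≤n , trans (proj₂ (proj₂ even) apart) (proj₂ (sound c<v (∈-concat⁺′ y∈L L∈)))

    remaining : ℕ → List ℕ
    remaining c = outs R′ n c ∖ concat (links c)

    -- The score of c in `R′` is even and every linked path at c uses up two out-edges.
    half : ∀ c → c < n → ∃ λ q → length (remaining c) ≡ q * 2
    half c c<n = even⇒2* _ (begin
      odd (length (remaining c))                                        ≡⟨⟩
      false xor odd (length (remaining c))                              ≡⟨ cong (_xor odd (length (remaining c))) (sym links-even) ⟩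
      odd (length (concat (links c))) xor odd (length (remaining c))    ≡⟨ odd-+ (length (concat (links c))) _ ⟨
      odd (length (concat (links c)) + length (remaining c))            ≡⟨ cong odd (length-∖ (links-unique c) (outs-unique R′ n c) ⊆outs) ⟨
      odd (length (outs R′ n c))                                        ≡⟨ cong odd (length-outs R′ n c) ⟩
      odd (score R′ n c)                                                ≡⟨ proj₁ (proj₂ even) c c<n ⟩
      false                                                             ∎)
      where
      open ≡-Reasoning
      ⊆outs : concat (links c) ⊆ outs R′ n c
      ⊆outs y∈ with y<n , c→y ← links-sound y∈ = ∈-outs⁺ R′ y<n c→y
      links-even : odd (length (concat (links c))) ≡ false
      links-even = trans (cong odd (length-concat (links c) length-links)) (odd-*2 (length (links c)))

    pairs : ℕ → List (List ℕ)
    pairs c with c <? n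
    ... | yes c<n = chunks 2 (proj₁ (half c c<n)) (remaining c)
    ... | no _    = []

    concat-pairs : ∀ {c} → c < n → concat (links c ++ pairs c) ≡ concat (links c) ++ remaining c
    concat-pairs {c} c<n = trans (sym (concat-++ (links c) (pairs c))) (cong (concat (links c) ++_) concat-pairs′)
      where
      concat-pairs′ : concat (pairs c) ≡ remaining c
      concat-pairs′ with c <? n
      ... | yes c<n′ = concat-chunks 2 (proj₁ (half c c<n′)) (remaining c) (proj₂ (half c c<n′))
      ... | no c≮n   = ⊥-elim (c≮n c<n)

    length-pairs : ∀ {c P} → P ∈ links c ++ pairs c → length P ≡ 2
    length-pairs {c} P∈ with ∈-++⁻ (links c) P∈
    ... | inj₁ P∈links = length-links P∈links
    ... | inj₂ P∈pairs with c <? n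
    ...   | yes c<n = length-chunk 2 (proj₁ (half c c<n)) (remaining c) (proj₂ (half c c<n)) P∈pairs
    length-pairs {c} P∈ | inj₂ () | no _

    P₃-system : StarSystem P₃ n
    P₃-system = record
      { tournament = R′
      ; leaves     = λ c → links c ++ pairs c
      ; disjoint   = λ {c} c<n → subst Unique (sym (concat-pairs c<n))
          (Unique.++⁺ (links-unique c) (Unique.filter⁺ _ (outs-unique R′ n c))
            λ (z∈ , z∈′) → proj₂ (∈-filter⁻ _ {xs = outs R′ n c} z∈′) z∈)
      ; sound      = λ {c} c<n y∈ → sound′ c (∈-++⁻ (concat (links c)) (subst (_ ∈_) (concat-pairs c<n) y∈))
      ; complete   = λ {c} {y} c<n y<n c→y → subst (_ ∈_) (sym (concat-pairs c<n)) (complete′ c (∈-outs⁺ R′ y<n c→y))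
      ; shape      = λ {c} u c<n L∈ → starGraph≅P₃ u (length-pairs {c} L∈)
      ; nonempty   = λ {c} c<n L∈ → nonempty-length (length-pairs {c} L∈)
      }
      where
      sound′ : ∀ c {y} → y ∈ concat (links c) ⊎ y ∈ remaining c → y < n × beats R′ c y ≡ true
      sound′ c (inj₁ y∈) = links-sound y∈
      sound′ c (inj₂ y∈) = ∈-outs⁻ R′ (proj₁ (∈-filter⁻ _ {xs = outs R′ n c} y∈))
      complete′ : ∀ c {y} → y ∈ outs R′ n c → y ∈ concat (links c) ++ remaining c
      complete′ c {y} y∈ with y ∈? concat (links c)
      ... | yes y∈′ = ∈-++⁺ˡ y∈′
      ... | no y∉   = ∈-++⁺ʳ (concat (links c)) (∈-filter⁺ _ y∈ y∉)

    open StarSystem P₃-system using () renaming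
      (stars to stars′; blockAt to blockAt′; ∈-stars⁺ to ∈-stars′⁺)

    linked : ∀ i → ∃ λ j → blockAt′ j ⊑ blockAt i
    linked i = Any.index P∈ , starGraph-⊑ (sym (cong proj₁ eq))
      λ y∈ → proj₁ (link-∈ {c} {L} (subst (_ ∈_) (sym (cong proj₂ eq)) y∈))
      where
      c = proj₁ (lookup stars i)
      L = proj₂ (lookup stars i)
      P∈ : (c , link c L) ∈ stars′
      P∈ with c<v , L∈ ← ∈-stars⁻ (∈-lookup i) =
        ∈-stars′⁺ (<-≤-trans (proj₁ (linkable c<v L∈)) v∸1≤n) (∈-++⁺ˡ (link-∈-links c<v L∈))
      eq : (c , link c L) ≡ lookup stars′ (Any.index P∈)
      eq = lookup-index P∈

    downLinkable : Σ (DesignOfOrder v Γ) λ 𝓑 → Σ (DesignOfOrder n P₃) λ 𝓑′ → DownLink (design 𝓑) (design 𝓑′)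
    downLinkable = starDesign , StarSystem.starDesign P₃-system , (λ i → proj₁ (linked i)) , (λ i → proj₂ (linked i))

-- Each star has at most three ineligible leaves: v ∸ 1 and the two neighbours of its centre.
large⇒linkable : ∀ {Γ v} (S : StarSystem Γ v) → let open StarSystem S in
  (∀ {c L} → c < v → L ∈ leaves c → c < v ∸ 1 × 5 ≤ length L) → Linkable S
large⇒linkable {v = v} S large {c} {L} c<v L∈ = proj₁ (large c<v L∈) , +-cancelʳ-≤ 3 2 _
  (≤-trans (proj₂ (large c<v L∈)) (≤-trans (≤-reflexive (length-∖ E! L! E⊆L)) (+-monoʳ-≤ (length E) bad≤3)))
  where
  open StarSystem S
  E = filter (eligible? v c) L
  L! : Unique L
  L! = part-unique (disjoint c<v) L∈
  E! : Unique E
  E! = Unique.filter⁺ (eligible? v c) L!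
  E⊆L : E ⊆ L
  E⊆L y∈ = proj₁ (∈-filter⁻ (eligible? v c) {xs = L} y∈)
  bad⊆ : L ∖ E ⊆ v ∸ 1 ∷ suc c ∷ c ∸ 1 ∷ []
  bad⊆ {y} y∈ with y∈L , y∉E ← ∈-filter⁻ _ {xs = L} y∈ with y ≟ suc c | c ≟ suc y
  ... | yes e | _ = there (here e)
  ... | no _  | yes refl = there (there (here refl))
  ... | no p  | no q with m≤n⇒m<n∨m≡n (<⇒≤pred (proj₁ (sound c<v (∈-concat⁺′ y∈L L∈))))
  ...   | inj₁ y<v∸1 = ⊥-elim (y∉E (∈-filter⁺ _ y∈L (y<v∸1 , p , q)))
  ...   | inj₂ e = here e
  bad≤3 : length (L ∖ E) ≤ 3
  bad≤3 = unique-⊆⇒length-≤ (Unique.filter⁺ _ L!) bad⊆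

-- Tournaments with scores 0, k and 2k

transitive : Tournament
transitive = record
  { beats  = λ x y → does (x <? y)
  ; irrefl = λ x → dec-false (x <? x) (<-irrefl refl)
  ; total  = λ x≢y → total′ (connex x≢y)
  }
  where
  connex : ∀ {x y} → x ≢ y → x < y ⊎ y < x
  connex {x} {y} x≢y with x <? y
  ... | yes x<y = inj₁ x<y
  ... | no x≮y = inj₂ (≤∧≢⇒< (≮⇒≥ x≮y) (≢-sym x≢y))
  total′ : ∀ {x y} → x < y ⊎ y < x → does (x <? y) ≡ not (does (y <? x))
  total′ {x} {y} (inj₁ x<y) = trans (dec-true (x <? y) x<y) (cong not (sym (dec-false (y <? x) (<⇒≯ x<y))))
  total′ {x} {y} (inj₂ y<x) = trans (dec-false (x <? y) (<⇒≯ y<x)) (cong not (sym (dec-true (y <? x) y<x)))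

reverseOn : {P : ℕ → ℕ → Set} → (∀ x y → Dec (P x y)) → (∀ {x y} → P x y → P y x) → (∀ {x} → ¬ P x x) → Tournament
reverseOn P? P-sym P-irr = toggle (λ x y → does (P? x y))
  (λ x y → does-⇔ (mk⇔ P-sym P-sym) (P? x y) (P? y x)) (λ x → dec-false (P? x x) P-irr) transitive

-- The p + g + h first vertices form three groups that beat each other cyclically.
module Cyclic (p g h : ℕ) where

  b : ℕ
  b = p + g + h

  -- Pairs from the first and the third group. Reversing these in the transitive tournament lets the
  -- third group beat the first and closes the cycle.
  Outer : ℕ → ℕ → Set
  Outer x y = x < p × p + g ≤ y × y < b

  Back : ℕ → ℕ → Set
  Back x y = Outer x y ⊎ Outer y x

  back? : ∀ x y → Dec (Back x y)
  back? x y = outer? x y ⊎-dec outer? y x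
    where
    outer? : ∀ x y → Dec (Outer x y)
    outer? x y = x <? p ×-dec (p + g ≤? y ×-dec y <? b)

  ¬outer : ∀ {x y} → y < p + g → ¬ Outer x y
  ¬outer y< (_ , ≤y , _) = <⇒≱ y< ≤y

  p≤p+g : p ≤ p + g
  p≤p+g = m≤m+n p g

  p+g≤b : p + g ≤ b
  p+g≤b = m≤m+n (p + g) h

  back-irrefl : ∀ {x} → ¬ Back x x
  back-irrefl (inj₁ o@(x<p , _)) = ¬outer (<-≤-trans x<p p≤p+g) o
  back-irrefl (inj₂ o@(x<p , _)) = ¬outer (<-≤-trans x<p p≤p+g) o

  cyclic : Tournament
  cyclic = reverseOn back? swap back-irrefl

  forward : ∀ {x y} → x < y → ¬ Back x y → toℕ (beats cyclic x y) ≡ 1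
  forward {x} {y} x<y ¬back = cong toℕ (cong₂ _xor_ (dec-false (back? x y) ¬back) (dec-true (x <? y) x<y))

  backward : ∀ {x y} → y < x → Back x y → toℕ (beats cyclic x y) ≡ 1
  backward {x} {y} y<x back = cong toℕ (cong₂ _xor_ (dec-true (back? x y) back) (dec-false (x <? y) (<⇒≯ y<x)))

  loses : ∀ {x y} → y ≤ x → ¬ Back x y → toℕ (beats cyclic x y) ≡ 0
  loses {x} {y} y≤x ¬back = cong toℕ (cong₂ _xor_ (dec-false (back? x y) ¬back) (dec-false (x <? y) (≤⇒≯ y≤x)))

  ones : ∀ s l {f} → (∀ i → i < l → f (s + i) ≡ 1) → l ≤ ∑ (s + l) f
  ones s l {f} f≡1 = ≤-trans (≤-reflexive (sym (trans (∑-cong l f≡1) (trans (∑-const l 1) (*-identityʳ l)))))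
    (≤-trans (m≤n+m _ (∑ s f)) (≤-reflexive (sym (∑-split s l))))

  beats-later : ∀ {x y} → x < b → b ≤ y → toℕ (beats cyclic x y) ≡ 1
  beats-later {x} {y} x<b b≤y = forward (<-≤-trans x<b b≤y) λ where
    (inj₁ (_ , _ , y<b)) → <⇒≱ y<b b≤y
    (inj₂ (y<p , _)) → <⇒≱ y<p (≤-trans (≤-trans p≤p+g p+g≤b) b≤y)

  module _ (a : ℕ) where

    -- After the b grouped vertices come `suc a` more, the last of them being v - 1; every grouped
    -- vertex beats all of these.
    v : ℕ
    v = suc (b + a)

    with-later : ∀ {x m} → x < b → m ≤ ∑ b (λ y → toℕ (beats cyclic x y)) → m + suc a ≤ score cyclic v x
    with-later {x} {m} x<b m≤ = subst (λ z → m + suc a ≤ score cyclic z x) (+-suc b a)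
      (subst (m + suc a ≤_) (sym (∑-split b (suc a)))
        (+-mono-≤ m≤ (ones 0 (suc a) λ i _ → beats-later x<b (m≤m+n b i))))

    module _ {d : ℕ} (p> : 0 < p → d ≤ g + suc a) (g> : 0 < g → d ≤ h + suc a) (h> : 0 < h → d ≤ p + suc a) where

      -- A vertex beats the whole next group and the `suc a` later vertices. The three bounds are
      -- conditional, so that an empty group imposes none.
      high-scores : ∀ {x} → x < b → d ≤ score cyclic v x
      high-scores {x} x<b with x <? p
      ... | yes x<p = ≤-trans (p> (≤-<-trans z≤n x<p)) (with-later x<b (≤-trans (ones p g one) (≤-trans (m≤m+n _ _) (≤-reflexive (sym (∑-split (p + g) h))))))
        where
        one : ∀ i → i < g → toℕ (beats cyclic x (p + i)) ≡ 1
        one i i<g = forward (<-≤-trans x<p (m≤m+n p i)) λ where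
          (inj₁ o) → ¬outer (+-monoʳ-< p i<g) o
          (inj₂ o) → ¬outer (<-≤-trans x<p p≤p+g) o
      ... | no x≮p with x <? p + g
      ...   | yes x<p+g = ≤-trans (g> (pos x<p+g)) (with-later x<b (ones (p + g) h one))
        where
        pos : x < p + g → 0 < g
        pos x<p+g = +-cancelˡ-< p 0 g (≤-<-trans (≤-trans (≤-reflexive (+-identityʳ p)) (≮⇒≥ x≮p)) x<p+g)
        one : ∀ i → i < h → toℕ (beats cyclic x (p + g + i)) ≡ 1
        one i i<h = forward (<-≤-trans x<p+g (m≤m+n (p + g) i)) λ where
          (inj₁ (x<p , _)) → x≮p x<p
          (inj₂ o) → ¬outer x<p+g o
      ...   | no x≮p+g = ≤-trans (h> pos) (with-later x<b (≤-trans (ones 0 p one)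
                (≤-trans (m≤m+n _ _) (≤-reflexive (sym (trans (cong (λ z → ∑ z (λ y → toℕ (beats cyclic x y))) (+-assoc p g h)) (∑-split p (g + h))))))))
        where
        pos : 0 < h
        pos = +-cancelˡ-< (p + g) 0 h (≤-<-trans (≤-trans (≤-reflexive (+-identityʳ (p + g))) (≮⇒≥ x≮p+g)) x<b)
        one : ∀ i → i < p → toℕ (beats cyclic x i) ≡ 1
        one i i<p = backward (<-≤-trans i<p (≮⇒≥ x≮p)) (inj₂ (i<p , ≮⇒≥ x≮p+g , x<b))

    last-score : score cyclic v (b + a) ≡ 0
    last-score = trans (∑-cong v λ y y<v → loses (≤-pred y<v) λ where
        (inj₁ (<p , _)) → <⇒≱ <p (≤-trans (≤-trans p≤p+g p+g≤b) (m≤m+n b a))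
        (inj₂ (_ , _ , <b)) → <⇒≱ <b (m≤m+n b a))
      (trans (∑-const v 0) (*-zeroʳ v))

-- The target score in units of k, that is, the number of stars centred at x.
level : ℕ → ℕ → ℕ → ℕ
level b a x with x <? b
... | yes _ = 2
... | no _ with x <? b + a
...   | yes _ = 1
...   | no _  = 0

module _ (b a : ℕ) where

  level-high : ∀ {x} → x < b → level b a x ≡ 2
  level-high {x} x<b with x <? b
  ... | yes _  = refl
  ... | no x≮b = ⊥-elim (x≮b x<b)

  level-low : ∀ {x} → b ≤ x → x < b + a → level b a x ≡ 1
  level-low {x} b≤x x<b+a with x <? b
  ... | yes x<b = ⊥-elim (<⇒≱ x<b b≤x)
  ... | no _ with x <? b + a
  ...   | yes _ = refl
  ...   | no x≮ = ⊥-elim (x≮ x<b+a)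

  level-last : ∀ {x} → b + a ≤ x → level b a x ≡ 0
  level-last {x} ≤x with x <? b
  ... | yes x<b = ⊥-elim (<⇒≱ x<b (≤-trans (m≤m+n b a) ≤x))
  ... | no _ with x <? b + a
  ...   | yes x< = ⊥-elim (<⇒≱ x< ≤x)
  ...   | no _ = refl

  level-≥1 : ∀ {x} → x < b + a → 1 ≤ level b a x
  level-≥1 {x} x<b+a with x <? b
  ... | yes _ = s≤s z≤n
  ... | no _ with x <? b + a
  ...   | yes _ = ≤-refl
  ...   | no x≮ = ⊥-elim (x≮ x<b+a)

  level-≤1 : ∀ {x} → b ≤ x → level b a x ≤ 1
  level-≤1 {x} b≤x with x <? b
  ... | yes x<b = ⊥-elim (<⇒≱ x<b b≤x)
  ... | no _ with x <? b + a
  ...   | yes _ = ≤-refl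
  ...   | no _ = z≤n

  module _ {k : ℕ} where

    ∑-level : ∑ (suc (b + a)) (λ x → level b a x * k) ≡ (b * 2 + a) * k
    ∑-level = trans (cong₂ _+_ (trans (∑-split b a) (cong₂ _+_ high low)) (cong (_* k) (level-last ≤-refl))) (lemma a b k)
      where
      high : ∑ b (λ x → level b a x * k) ≡ b * (2 * k)
      high = trans (∑-cong b λ x x<b → cong (_* k) (level-high x<b)) (∑-const b (2 * k))
      low : ∑ a (λ x → level b a (b + x) * k) ≡ a * k
      low = trans (∑-cong a λ x x<a → trans (cong (_* k) (level-low (m≤m+n b x) (+-monoʳ-< b x<a))) (*-identityˡ k)) (∑-const a k)
      lemma : ∀ a b k → b * (2 * k) + a * k + 0 * k ≡ (b * 2 + a) * k
      lemma = solve-∀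

    -- The first b vertices start at or above their targets and the last one starts at its target 0.
    -- So a vertex below target has level at most 1 and a vertex above it has level at least 1,
    -- which is the invariant `Monotone`.
    levelled : ∀ R → (∀ {x} → x < b → 2 * k ≤ score R (suc (b + a)) x) → score R (suc (b + a)) (b + a) ≡ 0 →
      (b * 2 + a) * k * 2 ≡ suc (b + a) * (b + a) →
      ∃ λ R′ → ∀ x → x < suc (b + a) → score R′ (suc (b + a)) x ≡ level b a x * k
    levelled R high last total≡ = ∃-tournament-with-scores v t
      (trans ∑-level (*-cancelʳ-≡ _ (tri v) 2 (trans total≡ (sym (tri-*2 v))))) R mono
      where
      v = suc (b + a)
      t = λ x → level b a x * k
      mono : Monotone v t R
      mono {x} {y} x<v _ over under with ≤-<-connex b y | ≤-<-connex (b + a) x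
      ... | inj₂ y<b | _ = ⊥-elim (<⇒≱ under (subst (_≤ score R v y) (cong (_* k) (sym (level-high y<b))) (high y<b)))
      ... | inj₁ b≤y | inj₂ x<b+a = *-monoˡ-≤ k (≤-trans (level-≤1 b≤y) (level-≥1 x<b+a))
      ... | inj₁ _   | inj₁ b+a≤x = ⊥-elim (<⇒≱ over (subst (_≤ t x) (sym (trans (cong (score R v) (≤-antisym (≤-pred x<v) b+a≤x)) last)) z≤n))

LinkableStars : ℕ → ℕ → Set
LinkableStars k v = Σ (StarSystem (star k) v) Linkable

-- With b = p + g + h, the conditions b + a = v - 1 and 2b + a = v(v - 1)/(2k), the number of stars,
-- give b = (v - 1)(v - 2k)/(2k). This is the source of the sizes chosen below for each order.
levelled-stars : ∀ p g h a k → 5 ≤ k →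
  (0 < p → 2 * k ≤ g + suc a) → (0 < g → 2 * k ≤ h + suc a) → (0 < h → 2 * k ≤ p + suc a) →
  ((p + g + h) * 2 + a) * k * 2 ≡ suc (p + g + h + a) * (p + g + h + a) → LinkableStars k (suc (p + g + h + a))
levelled-stars p g h a k (s≤s {n = k′} 4≤k′) p> g> h> total≡ = S , large⇒linkable S large
  where
  open Cyclic p g h using (b; cyclic; high-scores; last-score)
  v = suc (b + a)
  R = levelled b a cyclic (high-scores a p> g> h>) (last-score a) total≡
  S = tournament⇒starSystem (proj₁ R) v k′ (level b a) (proj₂ R)
  open StarSystem S
  large : ∀ {c L} → c < v → L ∈ leaves c → c < v ∸ 1 × 5 ≤ length L
  large {c} {L} c<v L∈ with ≤-<-connex (b + a) c
  ... | inj₂ c<b+a = c<b+a , subst (5 ≤_) (sym (length-chunk k (level b a c) _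
          (trans (length-outs (proj₁ R) v c) (proj₂ R c c<v)) L∈)) (s≤s 4≤k′)
  -- The last vertex has level 0 and is the centre of no star.
  ... | inj₁ b+a≤c with () ← subst (λ l → L ∈ chunks k l (outs (proj₁ R) v c)) (level-last b a b+a≤c) L∈

stars-2k : ∀ κ → 4 ≤ κ → LinkableStars (suc κ) (2 * suc κ)
stars-2k κ 4≤κ = subst (LinkableStars (suc κ)) (lemma κ)
  -- Here b = 0 and a = 2k - 1: every vertex but the last carries one star.
  (levelled-stars 0 0 0 (suc (2 * κ)) (suc κ) (s≤s 4≤κ) (λ ()) (λ ()) (λ ()) (count κ))
  where
  lemma : ∀ κ → suc (suc (2 * κ)) ≡ 2 * suc κ
  lemma = solve-∀
  count : ∀ κ → suc (2 * κ) * suc κ * 2 ≡ suc (suc (2 * κ)) * suc (2 * κ)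
  count = solve-∀

stars-2k+1 : ∀ κ → 4 ≤ κ → LinkableStars (suc κ) (suc (2 * suc κ))
stars-2k+1 κ 4≤κ = subst (LinkableStars (suc κ)) (lemma κ)
  -- Here b = 1 and a = 2k - 1: vertex 0 beats all 2k others and carries two stars.
  (levelled-stars 0 0 1 (suc (2 * κ)) (suc κ) (s≤s 4≤κ) (λ ()) (λ ()) (λ _ → ≤-reflexive (bound κ)) (count κ))
  where
  lemma : ∀ κ → suc (suc (suc (2 * κ))) ≡ suc (2 * suc κ)
  lemma = solve-∀
  bound : ∀ κ → 2 * suc κ ≡ suc (suc (2 * κ))
  bound = solve-∀
  count : ∀ κ → (2 + suc (2 * κ)) * suc κ * 2 ≡ suc (suc (suc (2 * κ))) * suc (suc (2 * κ))
  count = solve-∀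

module _ (j : ℕ) (5≤k : 5 ≤ suc (j * 2)) where

  private
    k : ℕ
    k = suc (j * 2)

  stars-3k : LinkableStars k (3 * k)
  stars-3k = subst (LinkableStars k) (lemma j)
    -- Here b = 3j + 1 is divided as evenly as possible; the first and third groups attain the
    -- required score 2k = 4j + 2 exactly.
    (levelled-stars j j (suc j) (suc (3 * j)) k 5≤k (λ _ → bound) (λ _ → ≤-trans bound (n≤1+n _)) (λ _ → bound) (count j))
    where
    lemma : ∀ j → suc (j + j + suc j + suc (3 * j)) ≡ 3 * suc (j * 2)
    lemma = solve-∀
    bound : 2 * k ≤ j + suc (suc (3 * j))
    bound = ≤-reflexive (eq j)
      where
      eq : ∀ j → 2 * suc (j * 2) ≡ j + suc (suc (3 * j))
      eq = solve-∀
    count : ∀ j → ((j + j + suc j) * 2 + suc (3 * j)) * suc (j * 2) * 2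
          ≡ suc (j + j + suc j + suc (3 * j)) * (j + j + suc j + suc (3 * j))
    count = solve-∀

  stars-3k+1 : LinkableStars k (suc (3 * k))
  stars-3k+1 = subst (LinkableStars k) (lemma j)
    -- Here b = 3(j + 1) splits into equal groups, each attaining the score 2k exactly.
    (levelled-stars (suc j) (suc j) (suc j) (3 * j) k 5≤k (λ _ → bound) (λ _ → bound) (λ _ → bound) (count j))
    where
    lemma : ∀ j → suc (suc j + suc j + suc j + 3 * j) ≡ suc (3 * suc (j * 2))
    lemma = solve-∀
    bound : 2 * k ≤ suc j + suc (3 * j)
    bound = ≤-reflexive (eq j)
      where
      eq : ∀ j → 2 * suc (j * 2) ≡ suc j + suc (3 * j)
      eq = solve-∀
    count : ∀ j → ((suc j + suc j + suc j) * 2 + 3 * j) * suc (j * 2) * 2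
          ≡ suc (suc j + suc j + suc j + 3 * j) * (suc j + suc j + suc j + 3 * j)
    count = solve-∀

-- Explicit star systems for k = 4

-- Four leaves are too few for `large⇒linkable`. All quantifiers being bounded, linkability is
-- instead decided by evaluation.
linkable? : ∀ {Γ v} (S : StarSystem Γ v) → let open StarSystem S in
  Dec (∀ {c} → c < v → All (λ L → c < v ∸ 1 × 2 ≤ length (filter (eligible? v c) L)) (leaves c))
linkable? {v = v} S = allUpTo? (λ c → All.all? (λ L → c <? v ∸ 1 ×-dec 2 ≤? length (filter (eligible? v c) L)) (leaves c)) v
  where open StarSystem S

-- Vertices 0,…,6 form the rotational tournament i → i+1, i+2, i+3 (mod 7).
Far : ℕ → ℕ → Set
Far x y = x < 7 × y < 7 × 4 ≤ ∣ x - y ∣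

far? : ∀ x y → Dec (Far x y)
far? x y = x <? 7 ×-dec (y <? 7 ×-dec 4 ≤? ∣ x - y ∣)

far-sym : ∀ {x y} → Far x y → Far y x
far-sym {x} {y} (x<7 , y<7 , 4≤) = y<7 , x<7 , subst (4 ≤_) (∣-∣-comm x y) 4≤

far-irrefl : ∀ {x} → ¬ Far x x
far-irrefl {x} (_ , _ , 4≤) with () ← subst (4 ≤_) (∣n-n∣≡0 x) 4≤

stars-4-8 : LinkableStars 4 8
stars-4-8 = S , λ c<v L∈ → All.lookup (toWitness {a? = linkable? S} tt c<v) L∈
  where
  R = reverseOn far? far-sym far-irrefl
  -- Vertex c < 7 beats c+1, c+2, c+3 (mod 7) and 7; of these leaves c+2 and c+3 are always
  -- eligible.
  S = tournament⇒starSystem R 8 3 (λ c → score R 8 c / 4)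
        (λ c c<v → toWitness {a? = allUpTo? (λ c → score R 8 c ≟ score R 8 c / 4 * 4) 8} tt c<v)

stars-4-9 : LinkableStars 4 9
stars-4-9 = S , λ c<v L∈ → All.lookup (toWitness {a? = linkable? S} tt c<v) L∈
  where
  -- Vertex 7 beats all others and so carries two stars.
  Reversed : ℕ → ℕ → Set
  Reversed x y = Far x y ⊎ ((x ≡ 7 × y < 7) ⊎ (y ≡ 7 × x < 7))
  reversed? : ∀ x y → Dec (Reversed x y)
  reversed? x y = far? x y ⊎-dec ((x ≟ 7 ×-dec y <? 7) ⊎-dec (y ≟ 7 ×-dec x <? 7))
  reversed-sym : ∀ {x y} → Reversed x y → Reversed y x
  reversed-sym (inj₁ far) = inj₁ (far-sym far)
  reversed-sym (inj₂ e)   = inj₂ (swap e)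
  reversed-irrefl : ∀ {x} → ¬ Reversed x x
  reversed-irrefl (inj₁ far) = far-irrefl far
  reversed-irrefl (inj₂ (inj₁ (refl , x<x))) = <-irrefl refl x<x
  reversed-irrefl (inj₂ (inj₂ (refl , x<x))) = <-irrefl refl x<x
  R = reverseOn reversed? reversed-sym reversed-irrefl
  -- The stars at 7 have leaves 0, 1, 2, 3 and 4, 5, 6, 8; in the second one 4 and 5 are eligible.
  S = tournament⇒starSystem R 9 3 (λ c → score R 9 c / 4)
        (λ c c<v → toWitness {a? = allUpTo? (λ c → score R 9 c ≟ score R 9 c / 4 * 4) 9} tt c<v)

-- The admissible orders

-- By induction on the exponent: Euclid's lemma puts one factor p into y, and this factor is
-- cancelled on both sides.
prime-power-divides : ∀ {p} → Prime p → ∀ m {x y} → ¬ p ∣ x → p ^ m ∣ x * y → p ^ m ∣ y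
prime-power-divides p-prime zero    {x} {y} _ _ = 1∣ y
prime-power-divides {p} p-prime (suc m) {x} {y} p∤x d
  with euclidsLemma x y p-prime (∣-trans (m∣m*n (p ^ m)) d)
... | inj₁ p∣x = ⊥-elim (p∤x p∣x)
... | inj₂ (divides y′ refl) = subst (p * p ^ m ∣_) (*-comm p y′)
        (*-monoʳ-∣ p (prime-power-divides p-prime m p∤x (*-cancelˡ-∣ p (subst (p * p ^ m ∣_) eq d))))
  where
  instance _ = prime⇒nonZero p-prime
  eq : x * (y′ * p) ≡ p * (x * y′)
  eq = trans (sym (*-assoc x y′ p)) (*-comm (x * y′) p)

-- A prime cannot divide both of two consecutive numbers, so the whole power goes to one of them.
prime-power-divides-consecutive : ∀ {p} → Prime p → ∀ m {w} → p ^ m ∣ suc w * w → p ^ m ∣ suc w ⊎ p ^ m ∣ w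
prime-power-divides-consecutive {p} p-prime m {w} d with p ∣? w
... | yes p∣w = inj₂ (prime-power-divides p-prime m p∤1+w d)
  where
  p∤1+w : ¬ p ∣ suc w
  p∤1+w p∣1+w = ¬prime[1] (subst Prime (∣1⇒≡1 (∣m+n∣m⇒∣n (subst (p ∣_) (+-comm 1 w) p∣1+w) p∣w)) p-prime)
... | no p∤w = inj₁ (prime-power-divides p-prime m p∤w (subst (p ^ m ∣_) (*-comm (suc w) w) d))

odd-* : ∀ m n → odd (m * n) ≡ odd m ∧ odd n
odd-* zero    n = refl
odd-* (suc m) n = trans (odd-+ n (m * n)) (trans (cong (odd n xor_) (odd-* m n)) (lemma (odd m) (odd n)))
  where
  lemma : ∀ a b → b xor (a ∧ b) ≡ not a ∧ b
  lemma false false = refl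
  lemma false true  = refl
  lemma true  false = refl
  lemma true  true  = refl

odd-prime-power : ∀ {p} → Prime p → p ≢ 2 → ∀ m → odd (p ^ m) ≡ true
odd-prime-power p-prime p≢2 zero = refl
odd-prime-power {p} p-prime p≢2 (suc m) = trans (odd-* p (p ^ m)) (cong₂ _∧_ odd-p (odd-prime-power p-prime p≢2 m))
  where
  odd-p : odd p ≡ true
  odd-p with odd p in e
  ... | true  = refl
  ... | false with q , eq ← even⇒2* p e with prime⇒irreducible p-prime (divides q eq)
  ...   | inj₁ ()
  ...   | inj₂ 2≡p = ⊥-elim (p≢2 (sym 2≡p))

odd⇒1+2* : ∀ n → odd n ≡ true → ∃ λ j → n ≡ suc (j * 2)
odd⇒1+2* (suc n) e with j , eq ← even⇒2* n (trans (sym (Bool.not-involutive (odd n))) (cong not e)) = j , cong suc eq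

-- The last two orders occur only for odd k and carry j = (k - 1)/2, from which the group sizes are
-- built.
data Order (k : ℕ) : ℕ → Set where
  2k   : Order k (2 * k)
  2k+1 : Order k (suc (2 * k))
  3k   : ∀ j → k ≡ suc (j * 2) → Order k (3 * k)
  3k+1 : ∀ j → k ≡ suc (j * 2) → Order k (suc (3 * k))

module _ {k : ℕ} (1<k : 1 < k) where

  private instance
    k≢0 : NonZero k
    k≢0 = >-nonZero (<-trans (s≤s z≤n) 1<k)

  -- The successor in the lower bound lets one lemma treat both v = qk and v = qk + 1.
  quotient-cases : ∀ {q} → 2 * k ≤ suc (q * k) → q * k < 4 * k → q ≡ 2 ⊎ q ≡ 3
  quotient-cases {0} lo _ = ⊥-elim (<⇒≱ (<-≤-trans 1<k (m≤m+n k _)) lo)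
  quotient-cases {1} lo _ = ⊥-elim (<⇒≱ (+-monoˡ-< (k + 0) 1<k) lo)
  quotient-cases {2} _ _ = inj₁ refl
  quotient-cases {3} _ _ = inj₂ refl
  quotient-cases {suc (suc (suc (suc q)))} _ hi =
    ⊥-elim (<⇒≱ hi (*-monoˡ-≤ k {4} {4 + q} (s≤s (s≤s (s≤s (s≤s z≤n))))))

  -- For odd p, k divides v or v - 1 with quotient 2 or 3. For p = 2, already 2k is a prime power
  -- and divides one of them, so the quotient by k is even and must be 2.
  orders : IsPrimePower k → ∀ v → 2 * k ≤ v → v < 4 * k → 2 * k ∣ v * (v ∸ 1) → Order k v
  orders _ zero lo _ _ = ⊥-elim (<⇒≱ (<-trans (s≤s z≤n) 1<k) (≤-trans (m≤m+n k _) lo))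
  orders (p , m , p-prime , 1≤m , refl) v@(suc w) lo hi d with p ≟ 2
  orders (2 , m , p-prime , 1≤m , refl) v@(suc w) lo hi d | yes refl = case (prime-power-divides-consecutive p-prime (suc m) d)
    where
    double : ∀ q → q * (2 * k) ≡ (q * 2) * k
    double q = sym (*-assoc q 2 k)
    q≡1 : ∀ q → q * 2 ≡ 2 ⊎ q * 2 ≡ 3 → q ≡ 1
    q≡1 1 _ = refl
    q≡1 0 (inj₁ ())
    q≡1 0 (inj₂ ())
    q≡1 (suc (suc q)) (inj₁ ())
    q≡1 (suc (suc q)) (inj₂ ())
    case : 2 * k ∣ suc w ⊎ 2 * k ∣ w → Order k v
    case (inj₁ (divides q eq)) with refl ← q≡1 q (quotient-cases
        (≤-trans lo (≤-trans (≤-reflexive (trans eq (double q))) (n≤1+n _))) (subst (_< 4 * k) (trans eq (double q)) hi))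
      = subst (Order k) (sym (trans eq (*-identityˡ (2 * k)))) 2k
    case (inj₂ (divides q eq)) with refl ← q≡1 q (quotient-cases
        (≤-trans lo (≤-reflexive (cong suc (trans eq (double q))))) (subst (_< 4 * k) (trans eq (double q)) (<-trans (n<1+n w) hi)))
      = subst (Order k) (cong suc (sym (trans eq (*-identityˡ (2 * k))))) 2k+1
  orders (p , m , p-prime , 1≤m , refl) v@(suc w) lo hi d | no p≢2
    with j , k≡ ← odd⇒1+2* k (odd-prime-power p-prime p≢2 m)
    = case (prime-power-divides-consecutive p-prime m (∣-trans (n∣m*n 2) d))
    where
    case : k ∣ suc w ⊎ k ∣ w → Order k v
    case (inj₁ (divides q eq)) with quotient-cases {q} (≤-trans lo (≤-trans (≤-reflexive eq) (n≤1+n _))) (subst (_< 4 * k) eq hi)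
    ... | inj₁ refl = subst (Order k) (sym eq) 2k
    ... | inj₂ refl = subst (Order k) (sym eq) (3k j k≡)
    case (inj₂ (divides q eq)) with quotient-cases {q} (≤-trans lo (≤-reflexive (cong suc eq))) (subst (_< 4 * k) eq (<-trans (n<1+n w) hi))
    ... | inj₁ refl = subst (Order k) (cong suc (sym eq)) 2k+1
    ... | inj₂ refl = subst (Order k) (cong suc (sym eq)) (3k+1 j k≡)

linkable-stars : ∀ {k v} → 3 < k → Order k v → LinkableStars k v
linkable-stars {k} 3<k o with m≤n⇒m<n∨m≡n 3<k
linkable-stars {suc κ} _ 2k   | inj₁ 4<k = stars-2k κ (s≤s⁻¹ 4<k)
linkable-stars {suc κ} _ 2k+1 | inj₁ 4<k = stars-2k+1 κ (s≤s⁻¹ 4<k)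
linkable-stars _ (3k j refl)   | inj₁ 4<k = stars-3k j 4<k
linkable-stars _ (3k+1 j refl) | inj₁ 4<k = stars-3k+1 j 4<k
linkable-stars _ 2k   | inj₂ refl = stars-4-8
linkable-stars _ 2k+1 | inj₂ refl = stars-4-9
-- The remaining orders need k odd, which excludes k = 4.
linkable-stars _ (3k (suc (suc j)) ()) | inj₂ refl
linkable-stars _ (3k+1 (suc (suc j)) ()) | inj₂ refl

theorem5p3 : (k : ℕ) → 3 < k → IsPrimePower k →
    (v : ℕ) → 2 * k ≤ v → v < 4 * k → 2 * k ∣ v * (v ∸ 1) →
    𝓛₁ (star k) v ≐ (λ n → v ∸ 1 ≤ n × (n % 4 ≡ 0 ⊎ n % 4 ≡ 1))
theorem5p3 k 3<k k-pp v lo hi d =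
  (λ linked → downLink-order linked , P₃-design-order (proj₁ (proj₂ linked))) ,
  λ (v∸1≤n , n%4) →
    let S , linkable = linkable-stars 3<k (orders (<-trans (s≤s (s≤s z≤n)) 3<k) k-pp v lo hi d)
    in Link.downLinkable S v∸1≤n n%4 linkable
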